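{- Let $\overline\alpha$ be coherent. Then for every $\mathfrak A\in K_{\overline\alpha}$ with $\delta(\mathfrak A)>0$ there is $\mathfrak D\in K_{\overline\alpha}$ with $\mathfrak A\subseteq\mathfrak D$ and $\delta(\mathfrak D)=0$.
   Context: Fix a finite relational language $L$ in which every relation symbol has arity at least $2$. $K_L$ is the class of all finite $L$-structures (including the empty one) in which every relation symbol is interpreted symmetrically and irreflexively. Fix $\overline\alpha:L\to(0,1]$, writing $\overline\alpha_E=\overline\alpha(E)$, such that it is not the case that all symbols of $L$ are binary and $\overline\alpha_E=1$ for all $E$. For $\mathfrak A\in K_L$ let $N_E(\mathfrak A)$ be the number of subsets of $A$ on which $E$ holds and $\delta(\mathfrak A)=|A|-\sum_{E}\overline\alpha_E N_E(\mathfrak A)$. $K_{\overline\alpha}=\{\mathfrak A\in K_L:\delta(\mathfrak A')\ge0\text{ for all substructures }\mathfrak A'\subseteq\mathfrak A\}$. $\overline\alpha$ is coherent if there are positive integers $m_E$ ($E\in L$) with $\sum_{E}m_E\overline\alpha_E\in\mathbb Q$. -}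

module Defs where

open import Level using (0ℓ)
open import Algebra.Bundles.Raw using (RawMonoid)
import Algebra.Definitions.RawMonoid as RawMonoidOps
open import Data.Bool using (Bool; T; T?)
import Data.Bool.Properties as Bool
open import Data.Fin using (Fin)
open import Data.Fin.Subset using (Subset; ⊥; ⁅_⁆; _∪_)
open import Data.Integer using (+_)
open import Data.List as List using (List; []; _∷_; length; filter; deduplicate; allFin; cartesianProductWith)
open import Data.List.Relation.Binary.Permutation.Propositional using (_↭_)
open import Data.Nat as ℕ using (ℕ; zero; suc; _⊔_)
import Data.Nat.Properties as ℕ
open import Data.Product using (_×_; _,_; ∃; ∃-syntax)
open import Data.Rational as ℚ using (ℚ; 0ℚ; 1ℚ; ½; ∣_∣; _/_)
import Data.Rational.Properties as ℚ
open import Data.Rational.Solver using (module +-*-Solver)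
open import Data.Vec as Vec using (Vec; []; _∷_; toList)
import Data.Vec.Properties as Vec
open import Data.Vec.Relation.Unary.Unique.Propositional using (Unique)
open import Function.Definitions using (Injective)
open import Relation.Binary.PropositionalEquality
  using (_≡_; refl; sym; trans; cong; subst; subst₂)

-- Cauchy sequences of rationals; equality of reals is _≃_, not _≡_.
record ℝ : Set where
  constructor mkℝ
  field
    seq    : ℕ → ℚ
    cauchy : ∀ ε → 0ℚ ℚ.< ε → ∃[ N ] (∀ m n → N ℕ.≤ m → N ℕ.≤ n →
             ∣ seq m ℚ.- seq n ∣ ℚ.< ε)

open ℝ public

infix 4 _<_ _≤_ _≃_

_<_ : ℝ → ℝ → Set
x < y = ∃[ ε ] (0ℚ ℚ.< ε × ∃[ N ] (∀ n → N ℕ.≤ n → seq x n ℚ.+ ε ℚ.≤ seq y n))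

_≤_ : ℝ → ℝ → Set
x ≤ y = ∀ ε → 0ℚ ℚ.< ε → ∃[ N ] (∀ n → N ℕ.≤ n → seq x n ℚ.≤ seq y n ℚ.+ ε)

_≃_ : ℝ → ℝ → Set
x ≃ y = ∀ ε → 0ℚ ℚ.< ε → ∃[ N ] (∀ n → N ℕ.≤ n → ∣ seq x n ℚ.- seq y n ∣ ℚ.< ε)

fromℚ : ℚ → ℝ
fromℚ q = mkℝ (λ _ → q) λ ε 0<ε →
  0 , λ _ _ _ _ → subst (λ r → ∣ r ∣ ℚ.< ε) (sym (ℚ.+-inverseʳ q)) 0<ε

fromℕ : ℕ → ℝ
fromℕ n = fromℚ (+ n / 1)

0ℝ 1ℝ : ℝ
0ℝ = fromℚ 0ℚ
1ℝ = fromℚ 1ℚ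

infixl 6 _+_ _-_
infix  8 -_

private
  0<½*ε : ∀ {ε} → 0ℚ ℚ.< ε → 0ℚ ℚ.< ½ ℚ.* ε
  0<½*ε {ε} 0<ε =
    subst (ℚ._< ½ ℚ.* ε) (ℚ.*-zeroʳ ½) (ℚ.*-monoʳ-<-pos ½ 0<ε)

  halves : ∀ ε → ½ ℚ.* ε ℚ.+ ½ ℚ.* ε ≡ ε
  halves ε = trans (sym (ℚ.*-distribʳ-+ ε ½ ½)) (ℚ.*-identityˡ ε)

  interchange : ∀ a b c d → (a ℚ.+ b) ℚ.- (c ℚ.+ d) ≡ (a ℚ.- c) ℚ.+ (b ℚ.- d)
  interchange = solve 4 (λ a b c d →
    ((a :+ b) :- (c :+ d)) := ((a :- c) :+ (b :- d))) refl
    where open +-*-Solver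

_+_ : ℝ → ℝ → ℝ
x + y = mkℝ (λ n → seq x n ℚ.+ seq y n) λ ε 0<ε →
  let M , x-close = cauchy x (½ ℚ.* ε) (0<½*ε 0<ε)
      N , y-close = cauchy y (½ ℚ.* ε) (0<½*ε 0<ε)
  in M ⊔ N , λ m n M⊔N≤m M⊔N≤n →
    subst₂ ℚ._<_
      (cong ∣_∣ (sym (interchange (seq x m) (seq y m) (seq x n) (seq y n))))
      (halves ε)
      (ℚ.≤-<-trans
        (ℚ.∣p+q∣≤∣p∣+∣q∣ (seq x m ℚ.- seq x n) (seq y m ℚ.- seq y n))
        (ℚ.+-mono-<
          (x-close m n (ℕ.m⊔n≤o⇒m≤o M N M⊔N≤m) (ℕ.m⊔n≤o⇒m≤o M N M⊔N≤n))
          (y-close m n (ℕ.m⊔n≤o⇒n≤o M N M⊔N≤m) (ℕ.m⊔n≤o⇒n≤o M N M⊔N≤n))))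

-_ : ℝ → ℝ
- x = mkℝ (λ n → ℚ.- seq x n) λ ε 0<ε →
  let N , x-close = cauchy x ε 0<ε
  in N , λ m n N≤m N≤n →
    subst (ℚ._< ε)
      (trans (sym (ℚ.∣-p∣≡∣p∣ (seq x m ℚ.- seq x n)))
             (cong ∣_∣ (ℚ.neg-distrib-+ (seq x m) (ℚ.- seq x n))))
      (x-close m n N≤m N≤n)

_-_ : ℝ → ℝ → ℝ
x - y = x + (- y)

ℝ-+-0-rawMonoid : RawMonoid 0ℓ 0ℓ
ℝ-+-0-rawMonoid = record { Carrier = ℝ ; _≈_ = _≃_ ; _∙_ = _+_ ; ε = 0ℝ }

-- n · x is the natural multiple n x; sum is the sum of a finite family.
open RawMonoidOps ℝ-+-0-rawMonoid public using (sum) renaming (_×_ to _·_)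

record Language : Set where
  field
    #symbols : ℕ
    arity    : Fin #symbols → ℕ
    2≤arity  : ∀ E → 2 ℕ.≤ arity E

  Symbol : Set
  Symbol = Fin #symbols

open Language public

-- The class K_L. Finite structures are taken up to isomorphism, so that the
-- universe is Fin card; inclusions then become embeddings.
record Structure (L : Language) : Set where
  field
    card        : ℕ
    rel         : (E : Symbol L) → Vec (Fin card) (arity L E) → Bool
    symmetric   : ∀ E {as bs} → toList as ↭ toList bs → rel E as ≡ rel E bs
    irreflexive : ∀ E {as} → T (rel E as) → Unique as

open Structure public

infix 4 _↪_

record _↪_ {L : Language} (A B : Structure L) : Set where
  field
    to        : Fin (card A) → Fin (card B)
    injective : Injective _≡_ _≡_ to
    rel-≡     : ∀ E as → rel B E (Vec.map to as) ≡ rel A E as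

open _↪_ public

tuples : ∀ n r → List (Vec (Fin n) r)
tuples n zero    = [] ∷ []
tuples n (suc r) = cartesianProductWith _∷_ (allFin n) (tuples n r)

underlyingSet : ∀ {n r} → Vec (Fin n) r → Subset n
underlyingSet []       = ⊥
underlyingSet (a ∷ as) = ⁅ a ⁆ ∪ underlyingSet as

-- E holds on a subset when some (equivalently, by symmetry, every)
-- enumeration of it without repetition satisfies E.
holdingSets : ∀ {L} (A : Structure L) → Symbol L → List (Subset (card A))
holdingSets {L} A E = deduplicate (Vec.≡-dec Bool._≟_)
  (List.map underlyingSet
    (filter (λ as → T? (rel A E as)) (tuples (card A) (arity L E))))

N : ∀ {L} → Symbol L → Structure L → ℕ
N E A = length (holdingSets A E)

Weights : Language → Set
Weights L = Symbol L → ℝ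

InUnitInterval : ∀ L → Weights L → Set
InUnitInterval L α = ∀ E → 0ℝ < α E × α E ≤ 1ℝ

AllBinaryOfWeightOne : ∀ L → Weights L → Set
AllBinaryOfWeightOne L α = ∀ E → arity L E ≡ 2 × α E ≃ 1ℝ

δ : ∀ {L} → Weights L → Structure L → ℝ
δ α A = fromℕ (card A) - sum (λ E → N E A · α E)

InK : ∀ {L} → Weights L → Structure L → Set
InK {L} α A = (A′ : Structure L) → A′ ↪ A → 0ℝ ≤ δ α A′

Coherent : ∀ L → Weights L → Set
Coherent L α = ∃ λ (m : Symbol L → ℕ) →
  (∀ E → 1 ℕ.≤ m E) × ∃[ q ] (sum (λ E → m E · α E) ≃ fromℚ q)

{-# OPTIONS --safe #-}
module Submission where

-- Distribute the weight of every edge over its vertices so that no vertex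
-- receives more than 1: then every substructure has δ ≥ 0, and if every vertex
-- receives exactly 1 then δ = 0.  Suppose a vertex a of A lies in no set of
-- predimension 0, and let S ∋ a have minimal predimension s; by submodularity
-- every set containing a has predimension at least s.  Coherence gives a multiset
-- of edges of total weight s + p for some large p.  Adding p new vertices and
-- laying these edges one after the other along the chain a, v₁, …, v_p, whose
-- cells have capacities s, 1, …, 1, every edge meets at most two cells because
-- α ≤ 1, so that the remaining vertices of the edge are free and can be used to
-- make the edges pairwise different.  Now S and the new vertices together form a
-- set of predimension 0.  Sets of predimension 0 are closed under unions, so
-- after finitely many such steps the whole structure has predimension 0.

open import Defs
open import Level using (0ℓ)
open import Axiom.ExcludedMiddle using (ExcludedMiddle)
open import Algebra.Bundles using (AbelianGroup)
import Algebra.Definitions.RawMonoid as RawMonoidOps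
open import Algebra.Properties.CommutativeMonoid.Sum using (∑-distrib-+; sum-cong-≋; sum-replicate-zero)
open import Algebra.Properties.Monoid.Mult using (×-homo-+; ×-congʳ)
import Algebra.Solver.CommutativeMonoid as CMSolver
open import Data.Bool using (Bool; true; false; if_then_else_; _∧_; _∨_; not; T; T?)
import Data.Bool.Properties as Bool
open import Data.Empty using (⊥-elim)
open import Data.Fin as Fin using (Fin; toℕ)
import Data.Fin.Properties as Fin
import Data.Fin.Subset as Subset
import Data.Fin.Subset.Properties as Subset
open import Data.Integer as ℤ using (+_; -[1+_])
import Data.Integer.Properties as ℤ
open import Data.List as List using (List; []; _∷_; length; _++_; applyUpTo; allFin)
import Data.List.Properties as List
open import Data.List.Membership.Propositional using (_∈_; find)
import Data.List.Membership.Propositional.Properties as ∈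
open import Data.List.Relation.Binary.Permutation.Propositional using (_↭_; ↭-refl; ↭-trans; ↭-sym; prep; ↭⇒↭ₛ)
import Data.List.Relation.Binary.Permutation.Propositional.Properties as ↭
import Data.List.Relation.Binary.Permutation.Setoid.Properties as Permutationₛ
open import Data.List.Relation.Binary.Subset.Propositional using (_⊆_)
open import Data.List.Relation.Unary.All as All using (All; []; _∷_)
import Data.List.Relation.Unary.All.Properties as All
open import Data.List.Relation.Unary.AllPairs as AllPairs using (AllPairs; []; _∷_)
import Data.List.Relation.Unary.AllPairs.Properties as AllPairs
open import Data.List.Relation.Unary.Any as Any using (here; there)
import Data.List.Relation.Unary.Any.Properties as Any
import Data.List.Relation.Unary.Unique.DecSetoid.Properties as UniqueDec
open import Data.List.Relation.Unary.Unique.DecPropositional.Properties using (deduplicate-!)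
open import Data.List.Relation.Unary.Unique.Propositional using (Unique)
import Data.List.Relation.Unary.Unique.Propositional.Properties as Unique
open import Data.Nat as ℕ using (ℕ; zero; suc; z≤n; s≤s; _%_; _∸_)
import Data.Nat.DivMod as ℕ
import Data.Nat.Properties as ℕ
open import Data.Nat.Solver using () renaming (module +-*-Solver to ℕ-Solver)
open import Data.Product using (_×_; _,_; proj₁; proj₂; ∃-syntax)
open import Data.Rational as ℚ using (ℚ; 0ℚ; 1ℚ; ½; ∣_∣; _/_)
import Data.Rational.Properties as ℚ
open import Data.Rational.Solver using () renaming (module +-*-Solver to ℚ-Solver)
open import Data.Rational.Unnormalised using (mkℚᵘ; *≡*; *≤*)
import Data.Rational.Unnormalised.Properties as ℚᵘ
open import Data.Sum using (_⊎_; inj₁; inj₂; [_,_]′)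
open import Data.Vec as Vec using (Vec; []; _∷_; toList)
import Data.Vec.Properties as Vec
import Data.Vec.Relation.Unary.All.Properties as VecAll
import Data.Vec.Relation.Unary.AllPairs as VecAllPairs
open import Data.Vec.Relation.Unary.Unique.Propositional using () renaming (Unique to VecUnique)
open import Function using (_∘_; mk⇔)
open import Relation.Binary.Bundles using (DecSetoid; TotalOrder)
open import Relation.Binary.PropositionalEquality using (_≡_; _≢_; refl; sym; trans; cong; cong₂; subst; subst₂; setoid)
import Relation.Binary.Reasoning.PartialOrder as PosetReasoning
open import Relation.Binary.Structures using (IsEquivalence; IsTotalOrder)
open import Relation.Nullary using (¬_; yes; no; contradiction; does)
open import Relation.Nullary.Decidable using (dec-true; dec-false; does-⇔)

-- Why the weights come out right: the edges inside `S` weigh |S| - s, and coherence completes every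
-- multiset of edges to one of integral weight m, as large as desired. The completing edges weigh m
-- - |S| + s, which is s plus an integer p. So the only fractional capacity on the chain is the s
-- that is available at `a`.
--
-- The obstacle is that edges of one symbol must be different sets, although a symbol may occur many
-- times. As all weights are at least some ε > 0, boundedly many edges begin in one cell. Closing
-- the chain to a long cycle gives every edge room to record its cell and a bounded number. Edges
-- near the end may wrap around to `a`. This is harmless: additional vertices only make it harder
-- for a region to contain an edge, and the final set contains the whole cycle.
--
-- Excluded middle is needed to compare a weight with a remaining capacity, since the order of
-- Cauchy reals is not decidable.

-- Order and addition of Cauchy reals

module Real where
  -- The equation says b - a = d - c. In this form a linear inequality is reduced to a known one by
  -- an identity that the ring solver proves.
  ℚ-shift-≤ : ∀ {a b} c d → c ℚ.≤ d → b ℚ.+ c ≡ d ℚ.+ a → a ℚ.≤ b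
  ℚ-shift-≤ {a} {b} c d c≤d eq = subst₂ ℚ._≤_ (lhs a c)
    (trans (rhs a c d) (trans (cong (ℚ._- c) (sym eq)) (lhs′ b c)))
    (ℚ.+-monoʳ-≤ (a ℚ.- c) c≤d)
    where
    open ℚ-Solver
    lhs : ∀ a c → (a ℚ.- c) ℚ.+ c ≡ a
    lhs = solve 2 (λ a c → (a :- c) :+ c := a) refl
    lhs′ : ∀ a c → (a ℚ.+ c) ℚ.- c ≡ a
    lhs′ = solve 2 (λ a c → (a :+ c) :- c := a) refl
    rhs : ∀ a c d → (a ℚ.- c) ℚ.+ d ≡ (d ℚ.+ a) ℚ.- c
    rhs = solve 3 (λ a c d → (a :- c) :+ d := (d :+ a) :- c) refl

  0<½* : ∀ {ε} → 0ℚ ℚ.< ε → 0ℚ ℚ.< ½ ℚ.* ε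
  0<½* {ε} 0<ε = subst (ℚ._< ½ ℚ.* ε) (ℚ.*-zeroʳ ½) (ℚ.*-monoʳ-<-pos ½ 0<ε)

  ½*+½* : ∀ ε → ½ ℚ.* ε ℚ.+ ½ ℚ.* ε ≡ ε
  ½*+½* ε = trans (sym (ℚ.*-distribʳ-+ ε ½ ½)) (ℚ.*-identityˡ ε)

  ½*< : ∀ {ε} → 0ℚ ℚ.< ε → ½ ℚ.* ε ℚ.< ε
  ½*< {ε} 0<ε = subst₂ ℚ._<_ (ℚ.+-identityʳ _) (½*+½* ε) (ℚ.+-monoʳ-< (½ ℚ.* ε) (0<½* 0<ε))

  p≤∣p∣ : ∀ p → p ℚ.≤ ∣ p ∣
  p≤∣p∣ p with ℚ.∣p∣≡p∨∣p∣≡-p p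
  ... | inj₁ eq = ℚ.≤-reflexive (sym eq)
  ... | inj₂ eq = ℚ.≤-trans
    (ℚ-shift-≤ 0ℚ (ℚ.- p) (subst (0ℚ ℚ.≤_) eq (ℚ.0≤∣p∣ p)) (sym (ℚ.+-inverseˡ p))) (ℚ.0≤∣p∣ p)

  ∣-∣-sym : ∀ p q → ∣ p ℚ.- q ∣ ≡ ∣ q ℚ.- p ∣
  ∣-∣-sym p q = trans (sym (ℚ.∣-p∣≡∣p∣ (p ℚ.- q))) (cong ∣_∣ (lem p q))
    where
    open ℚ-Solver
    lem : ∀ p q → ℚ.- (p ℚ.- q) ≡ q ℚ.- p
    lem = solve 2 (λ p q → :- (p :- q) := q :- p) refl

  ∣p-q∣<ε⇒p≤q+ε : ∀ p q {ε} → ∣ p ℚ.- q ∣ ℚ.< ε → p ℚ.≤ q ℚ.+ ε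
  ∣p-q∣<ε⇒p≤q+ε p q {ε} lt =
    ℚ-shift-≤ (p ℚ.- q) ε (ℚ.≤-trans (p≤∣p∣ _) (ℚ.<⇒≤ lt)) (lem p q ε)
    where
    open ℚ-Solver
    lem : ∀ p q ε → (q ℚ.+ ε) ℚ.+ (p ℚ.- q) ≡ ε ℚ.+ p
    lem = solve 3 (λ p q ε → (q :+ ε) :+ (p :- q) := ε :+ p) refl

  p≤p+ε : ∀ p {ε} → 0ℚ ℚ.< ε → p ℚ.≤ p ℚ.+ ε
  p≤p+ε p {ε} 0<ε = subst (ℚ._≤ p ℚ.+ ε) (ℚ.+-identityʳ p) (ℚ.+-monoʳ-≤ p (ℚ.<⇒≤ 0<ε))

  ≤-ptw : ∀ x y → (∀ n → seq x n ℚ.≤ seq y n) → x ≤ y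
  ≤-ptw x y x≤y ε 0<ε = 0 , λ n _ → ℚ.≤-trans (x≤y n) (p≤p+ε (seq y n) 0<ε)

  ≃⇒≤ : ∀ x y → x ≃ y → x ≤ y
  ≃⇒≤ x y x≃y ε 0<ε with x≃y ε 0<ε
  ... | N , close = N , λ n N≤n → ∣p-q∣<ε⇒p≤q+ε (seq x n) (seq y n) (close n N≤n)

  ≃-sym : ∀ x y → x ≃ y → y ≃ x
  ≃-sym x y x≃y ε 0<ε with x≃y ε 0<ε
  ... | N , close = N , λ n N≤n → subst (ℚ._< ε) (∣-∣-sym (seq x n) (seq y n)) (close n N≤n)

  ≤-antisym : ∀ x y → x ≤ y → y ≤ x → x ≃ y
  ≤-antisym x y x≤y y≤x ε 0<ε with x≤y _ (0<½* 0<ε) | y≤x _ (0<½* 0<ε)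
  ... | M , p | N , q = M ℕ.⊔ N , λ n M⊔N≤n → ℚ.≤-<-trans
      (bound (seq x n) (seq y n) (p n (ℕ.m⊔n≤o⇒m≤o M N M⊔N≤n)) (q n (ℕ.m⊔n≤o⇒n≤o M N M⊔N≤n)))
      (½*< 0<ε)
    where
    open ℚ-Solver
    bound : ∀ p q {h} → p ℚ.≤ q ℚ.+ h → q ℚ.≤ p ℚ.+ h → ∣ p ℚ.- q ∣ ℚ.≤ h
    bound p q {h} le ge with ℚ.∣p∣≡p∨∣p∣≡-p (p ℚ.- q)
    ... | inj₁ eq = subst (ℚ._≤ h) (sym eq) (ℚ-shift-≤ _ _ le
      (solve 3 (λ p q h → h :+ p := (q :+ h) :+ (p :- q)) refl p q h))
    ... | inj₂ eq = subst (ℚ._≤ h) (sym eq) (ℚ-shift-≤ _ _ ge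
      (solve 3 (λ p q h → h :+ q := (p :+ h) :+ (:- (p :- q))) refl p q h))

  ≤-trans : ∀ x y z → x ≤ y → y ≤ z → x ≤ z
  ≤-trans x y z x≤y y≤z ε 0<ε with x≤y _ (0<½* 0<ε) | y≤z _ (0<½* 0<ε)
  ... | M , p | N , q = M ℕ.⊔ N , λ n M⊔N≤n → ℚ.≤-trans
    (p n (ℕ.m⊔n≤o⇒m≤o M N M⊔N≤n))
    (ℚ.≤-trans (ℚ.+-monoˡ-≤ _ (q n (ℕ.m⊔n≤o⇒n≤o M N M⊔N≤n)))
      (ℚ.≤-reflexive (trans (ℚ.+-assoc (seq z n) _ _) (cong (seq z n ℚ.+_) (½*+½* ε)))))

  ≃-ptw : ∀ x y → (∀ n → seq x n ≡ seq y n) → x ≃ y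
  ≃-ptw x y x≡y = ≤-antisym x y (≤-ptw x y λ n → ℚ.≤-reflexive (x≡y n))
    (≤-ptw y x λ n → ℚ.≤-reflexive (sym (x≡y n)))

  ≃-refl : ∀ x → x ≃ x
  ≃-refl x = ≃-ptw x x λ _ → refl

  ≃-trans : ∀ x y z → x ≃ y → y ≃ z → x ≃ z
  ≃-trans x y z x≃y y≃z = ≤-antisym x z
    (≤-trans x y z (≃⇒≤ x y x≃y) (≃⇒≤ y z y≃z))
    (≤-trans z y x (≃⇒≤ z y (≃-sym y z y≃z)) (≃⇒≤ y x (≃-sym x y x≃y)))

  +-mono-≤ : ∀ x y u v → x ≤ y → u ≤ v → x + u ≤ y + v
  +-mono-≤ x y u v x≤y u≤v ε 0<ε with x≤y _ (0<½* 0<ε) | u≤v _ (0<½* 0<ε)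
  ... | M , p | N , q = M ℕ.⊔ N , λ n M⊔N≤n → ℚ.≤-trans
    (ℚ.+-mono-≤ (p n (ℕ.m⊔n≤o⇒m≤o M N M⊔N≤n)) (q n (ℕ.m⊔n≤o⇒n≤o M N M⊔N≤n)))
    (ℚ.≤-reflexive (trans (lem (seq y n) (seq v n) (½ ℚ.* ε)) (cong (seq y n ℚ.+ seq v n ℚ.+_) (½*+½* ε))))
    where
    open ℚ-Solver
    lem : ∀ y v h → (y ℚ.+ h) ℚ.+ (v ℚ.+ h) ≡ (y ℚ.+ v) ℚ.+ (h ℚ.+ h)
    lem = solve 3 (λ y v h → (y :+ h) :+ (v :+ h) := (y :+ v) :+ (h :+ h)) refl

  +-cong : ∀ x y u v → x ≃ y → u ≃ v → x + u ≃ y + v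
  +-cong x y u v x≃y u≃v = ≤-antisym (x + u) (y + v)
    (+-mono-≤ x y u v (≃⇒≤ x y x≃y) (≃⇒≤ u v u≃v))
    (+-mono-≤ y x v u (≃⇒≤ y x (≃-sym x y x≃y)) (≃⇒≤ v u (≃-sym u v u≃v)))

  neg-antimono-≤ : ∀ x y → x ≤ y → - y ≤ - x
  neg-antimono-≤ x y x≤y ε 0<ε with x≤y ε 0<ε
  ... | N , p = N , λ n N≤n → ℚ-shift-≤ _ _ (p n N≤n)
    (solve 3 (λ x y e → (:- x :+ e) :+ x := (y :+ e) :+ :- y) refl (seq x n) (seq y n) ε)
    where open ℚ-Solver

  neg-cong : ∀ x y → x ≃ y → - x ≃ - y
  neg-cong x y x≃y = ≤-antisym (- x) (- y) (neg-antimono-≤ y x (≃⇒≤ y x (≃-sym x y x≃y)))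
    (neg-antimono-≤ x y (≃⇒≤ x y x≃y))

  <⇒≰ : ∀ x y → x < y → ¬ (y ≤ x)
  <⇒≰ x y (ε , 0<ε , M , p) y≤x with y≤x _ (0<½* 0<ε)
  ... | N , q = ℚ.<-irrefl refl (ℚ.<-≤-trans (½*< 0<ε)
    (ℚ-shift-≤ _ _ (ℚ.+-mono-≤ (p n (ℕ.m≤m⊔n M N)) (q n (ℕ.m≤n⊔m M N)))
      (solve 4 (λ x y e h → h :+ ((x :+ e) :+ y) := (y :+ (x :+ h)) :+ e) refl
        (seq x n) (seq y n) ε (½ ℚ.* ε))))
    where
    n = M ℕ.⊔ N
    open ℚ-Solver

  -- If no gap `ε` by which x exceeds y recurs arbitrarily late, then x ≤ y. If a gap `ε₀` does
  -- recur, one late occurrence at `k` suffices: by the Cauchy property each sequence moves by less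
  -- than half of `ε₀` from there on, so y never overtakes x again.
  ≰⇒≥ : ExcludedMiddle 0ℓ → ∀ x y → ¬ (x ≤ y) → y ≤ x
  ≰⇒≥ em x y x≰y with em {∃[ ε ] (0ℚ ℚ.< ε × (∀ N → ∃[ n ] (N ℕ.≤ n × seq y n ℚ.+ ε ℚ.< seq x n)))}
  ... | no ¬gap = contradiction x≤y x≰y
    where
    x≤y : x ≤ y
    x≤y ε 0<ε with em {∃[ N ] (∀ n → N ℕ.≤ n → seq x n ℚ.≤ seq y n ℚ.+ ε)}
    ... | yes p = p
    ... | no ¬p = contradiction (ε , 0<ε , λ N → far N) ¬gap
      where
      far : ∀ N → ∃[ n ] (N ℕ.≤ n × seq y n ℚ.+ ε ℚ.< seq x n)
      far N with em {∃[ n ] (N ℕ.≤ n × seq y n ℚ.+ ε ℚ.< seq x n)}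
      ... | yes q = q
      ... | no ¬q = contradiction (N , λ n N≤n → ℚ.≮⇒≥ λ lt → ¬q (n , N≤n , lt)) ¬p
  ... | yes (ε₀ , 0<ε₀ , far) with cauchy x _ (0<½* 0<ε₀) | cauchy y _ (0<½* 0<ε₀)
  ...   | M , x-close | N , y-close with far (M ℕ.⊔ N)
  ...     | k , M⊔N≤k , lt = λ ε 0<ε → M ℕ.⊔ N , λ n M⊔N≤n → ℚ.≤-trans
    (below (seq x n) (seq y n) (seq x k) (seq y k) (½*+½* ε₀) (ℚ.<⇒≤ lt)
      (∣p-q∣<ε⇒p≤q+ε (seq x k) (seq x n) (x-close k n (ℕ.m⊔n≤o⇒m≤o M N M⊔N≤k) (ℕ.m⊔n≤o⇒m≤o M N M⊔N≤n)))
      (∣p-q∣<ε⇒p≤q+ε (seq y n) (seq y k) (y-close n k (ℕ.m⊔n≤o⇒n≤o M N M⊔N≤n) (ℕ.m⊔n≤o⇒n≤o M N M⊔N≤k))))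
    (p≤p+ε (seq x n) 0<ε)
    where
    below : ∀ xn yn xk yk {h ε} → h ℚ.+ h ≡ ε → yk ℚ.+ ε ℚ.≤ xk → xk ℚ.≤ xn ℚ.+ h → yn ℚ.≤ yk ℚ.+ h → yn ℚ.≤ xn
    below xn yn xk yk {h} refl p q r = ℚ-shift-≤ _ _ (ℚ.+-mono-≤ p (ℚ.+-mono-≤ q r))
      (solve 5 (λ xn yn xk yk h → xn :+ ((yk :+ (h :+ h)) :+ (xk :+ yn)) :=
        (xk :+ ((xn :+ h) :+ (yk :+ h))) :+ yn) refl xn yn xk yk h)
      where open ℚ-Solver

  ≤-total : ExcludedMiddle 0ℓ → ∀ x y → x ≤ y ⊎ y ≤ x
  ≤-total em x y with em {x ≤ y}
  ... | yes x≤y = inj₁ x≤y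
  ... | no  x≰y = inj₂ (≰⇒≥ em x y x≰y)

  /1-+ : ∀ i j → (i ℤ.+ j) / 1 ≡ i / 1 ℚ.+ j / 1
  /1-+ i j = ℚ.toℚᵘ-injective (ℚᵘ.≃-trans (ℚ.toℚᵘ-fromℚᵘ (mkℚᵘ (i ℤ.+ j) 0))
    (ℚᵘ.≃-trans (*≡* (cong (ℤ._* + 1) (cong₂ ℤ._+_ (sym (ℤ.*-identityʳ i)) (sym (ℤ.*-identityʳ j)))))
    (ℚᵘ.≃-sym (ℚᵘ.≃-trans (ℚ.toℚᵘ-homo-+ (i / 1) (j / 1))
      (ℚᵘ.+-cong (ℚ.toℚᵘ-fromℚᵘ (mkℚᵘ i 0)) (ℚ.toℚᵘ-fromℚᵘ (mkℚᵘ j 0)))))))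

  /1-mono : ∀ {i j} → i ℤ.≤ j → i / 1 ℚ.≤ j / 1
  /1-mono {i} {j} i≤j = ℚ.toℚᵘ-cancel-≤ (ℚᵘ.≤-respˡ-≃ (ℚᵘ.≃-sym (ℚ.toℚᵘ-fromℚᵘ (mkℚᵘ i 0)))
    (ℚᵘ.≤-respʳ-≃ (ℚᵘ.≃-sym (ℚ.toℚᵘ-fromℚᵘ (mkℚᵘ j 0)))
      (*≤* (subst₂ ℤ._≤_ (sym (ℤ.*-identityʳ i)) (sym (ℤ.*-identityʳ j)) i≤j))))

  fromℕ-suc : ∀ n → fromℕ (suc n) ≃ 1ℝ + fromℕ n
  fromℕ-suc n = ≃-ptw (fromℕ (suc n)) (1ℝ + fromℕ n) λ _ → /1-+ (+ 1) (+ n)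

  fromℕ≃·1 : ∀ n → fromℕ n ≃ n · 1ℝ
  fromℕ≃·1 zero    = ≃-refl 0ℝ
  fromℕ≃·1 (suc n) = ≃-trans (fromℕ (suc n)) (1ℝ + fromℕ n) (suc n · 1ℝ) (fromℕ-suc n)
    (+-cong 1ℝ 1ℝ (fromℕ n) (n · 1ℝ) (≃-refl 1ℝ) (fromℕ≃·1 n))

  ·-fromℚ : ∀ k q → k · fromℚ q ≃ fromℚ (+ k / 1 ℚ.* q)
  ·-fromℚ zero    q = ≃-ptw 0ℝ (fromℚ (0ℚ ℚ.* q)) λ _ → sym (ℚ.*-zeroˡ q)
  ·-fromℚ (suc k) q = ≃-trans (suc k · fromℚ q) (fromℚ q + fromℚ (+ k / 1 ℚ.* q)) (fromℚ (+ suc k / 1 ℚ.* q))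
    (+-cong (fromℚ q) (fromℚ q) (k · fromℚ q) (fromℚ (+ k / 1 ℚ.* q)) (≃-refl (fromℚ q)) (·-fromℚ k q))
    (≃-ptw (fromℚ q + fromℚ (+ k / 1 ℚ.* q)) (fromℚ (+ suc k / 1 ℚ.* q)) λ _ →
      sym (trans (cong (ℚ._* q) (/1-+ (+ 1) (+ k)))
        (trans (ℚ.*-distribʳ-+ q 1ℚ (+ k / 1)) (cong (ℚ._+ (+ k / 1 ℚ.* q)) (ℚ.*-identityˡ q)))))

  ↧*q≡↥ : ∀ q → + ℚ.↧ₙ q / 1 ℚ.* q ≡ ℚ.↥ q / 1
  ↧*q≡↥ q@(ℚ.mkℚ i d _) = ℚ.toℚᵘ-injective
    (ℚᵘ.≃-trans (ℚ.toℚᵘ-homo-* (+ suc d / 1) q)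
    (ℚᵘ.≃-trans (ℚᵘ.*-cong (ℚ.toℚᵘ-fromℚᵘ (mkℚᵘ (+ suc d) 0)) (ℚᵘ.≃-refl {ℚ.toℚᵘ q}))
    (ℚᵘ.≃-trans (*≡* (trans (ℤ.*-identityʳ _) (trans (ℤ.*-comm (+ suc d) i)
       (cong (i ℤ.*_) (cong (λ n → + suc n) (sym (ℕ.+-identityʳ d)))))))
    (ℚᵘ.≃-sym (ℚ.toℚᵘ-fromℚᵘ (mkℚᵘ i 0))))))

  ↧·fromℚ : ∀ q → ℚ.↧ₙ q · fromℚ q ≃ fromℚ (ℚ.↥ q / 1)
  ↧·fromℚ q = subst (λ r → ℚ.↧ₙ q · fromℚ q ≃ fromℚ r) (↧*q≡↥ q) (·-fromℚ (ℚ.↧ₙ q) q)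

  ·-mono-≤ : ∀ n x y → x ≤ y → n · x ≤ n · y
  ·-mono-≤ zero    x y x≤y = ≤-ptw 0ℝ 0ℝ λ _ → ℚ.≤-refl
  ·-mono-≤ (suc n) x y x≤y = +-mono-≤ x y (n · x) (n · y) x≤y (·-mono-≤ n x y x≤y)

  ·-cong : ∀ n x y → x ≃ y → n · x ≃ n · y
  ·-cong n x y x≃y = ≤-antisym (n · x) (n · y) (·-mono-≤ n x y (≃⇒≤ x y x≃y))
    (·-mono-≤ n y x (≃⇒≤ y x (≃-sym x y x≃y)))

  -- The rational witness of 0 < x is a lower bound of x, and a positive fraction times its
  -- denominator is its numerator, which is at least 1.
  archimedean : ∀ x → 0ℝ < x → ∃[ k ] (1ℝ ≤ k · x)
  archimedean x (ε@(ℚ.mkℚ (+ zero) _ _) , 0<ε , _) = contradiction (ℚ.positive 0<ε) λ ()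
  archimedean x (ε@(ℚ.mkℚ -[1+ _ ] _ _) , 0<ε , _) = contradiction (ℚ.positive 0<ε) λ ()
  archimedean x (ε@(ℚ.mkℚ (+ suc i) d _) , 0<ε , N , p) = suc d ,
    ≤-trans 1ℝ (suc d · fromℚ ε) (suc d · x)
      (≤-trans 1ℝ (fromℕ (suc i)) (suc d · fromℚ ε)
        (≤-ptw 1ℝ (fromℕ (suc i)) λ _ → /1-mono {+ 1} {+ suc i} (ℤ.+≤+ (s≤s z≤n)))
        (≃⇒≤ (fromℕ (suc i)) (suc d · fromℚ ε)
          (≃-sym (suc d · fromℚ ε) (fromℕ (suc i)) (↧·fromℚ ε))))
      (·-mono-≤ (suc d) (fromℚ ε) x ε≤x)
    where
    ε≤x : fromℚ ε ≤ x
    ε≤x e 0<e = N , λ n N≤n → ℚ.≤-trans (subst (ℚ._≤ seq x n) (ℚ.+-identityˡ ε) (p n N≤n))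
      (p≤p+ε (seq x n) 0<e)

-- Totally ordered abelian groups, with the reals as an instance

-- The combinatorial part of the argument uses only the ordered additive group of ℝ.
record OrderedAbelianGroup : Set₁ where
  infix 4 _≼_
  field
    abelianGroup : AbelianGroup 0ℓ 0ℓ
  open AbelianGroup abelianGroup public
    renaming (_∙_ to _⊕_; ε to 0#; _⁻¹ to ⊖_; refl to ≈-refl; sym to ≈-sym; trans to ≈-trans;
              ∙-cong to ⊕-cong; ∙-congˡ to ⊕-congˡ; ∙-congʳ to ⊕-congʳ; comm to ⊕-comm; assoc to ⊕-assoc;
              identityˡ to ⊕-identityˡ; identityʳ to ⊕-identityʳ)
  open RawMonoidOps rawMonoid public using () renaming (_×_ to _⋆_; sum to ∑)
  field
    _≼_          : Carrier → Carrier → Set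
    isTotalOrder : IsTotalOrder _≈_ _≼_
    ⊕-monoʳ-≼    : ∀ x {y z} → y ≼ z → x ⊕ y ≼ x ⊕ z
    1#           : Carrier
    0≼1          : 0# ≼ 1#

  totalOrder : TotalOrder 0ℓ 0ℓ 0ℓ
  totalOrder = record { isTotalOrder = isTotalOrder }

  open TotalOrder totalOrder public using (poset)
    renaming (refl to ≼-refl; reflexive to ≼-reflexive; trans to ≼-trans; total to ≼-total; antisym to ≼-antisym)

  infixr 8 _#1
  _#1 : ℕ → Carrier
  n #1 = n ⋆ 1#

module OrderedAbelianGroupProperties (G : OrderedAbelianGroup) where
  open OrderedAbelianGroup G
  open CMSolver commutativeMonoid public using (solve; _⊜_) renaming (_⊕_ to _:+_)
  module ≼-Reasoning = PosetReasoning poset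
  open ≼-Reasoning

  ⊕-monoˡ-≼ : ∀ x {y z} → y ≼ z → y ⊕ x ≼ z ⊕ x
  ⊕-monoˡ-≼ x {y} {z} y≼z = begin
    y ⊕ x ≈⟨ ⊕-comm y x ⟩
    x ⊕ y ≤⟨ ⊕-monoʳ-≼ x y≼z ⟩
    x ⊕ z ≈⟨ ⊕-comm x z ⟩
    z ⊕ x ∎

  ⊕-mono-≼ : ∀ {x y u v} → x ≼ y → u ≼ v → x ⊕ u ≼ y ⊕ v
  ⊕-mono-≼ {x} {y} {u} {v} x≼y u≼v = ≼-trans (⊕-monoʳ-≼ x u≼v) (⊕-monoˡ-≼ v x≼y)

  ⊕-cancelˡ-≼ : ∀ x {y z} → x ⊕ y ≼ x ⊕ z → y ≼ z
  ⊕-cancelˡ-≼ x {y} {z} le = begin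
    y              ≈⟨ lem y ⟨
    ⊖ x ⊕ (x ⊕ y)  ≤⟨ ⊕-monoʳ-≼ (⊖ x) le ⟩
    ⊖ x ⊕ (x ⊕ z)  ≈⟨ lem z ⟩
    z              ∎
    where
    lem : ∀ y → ⊖ x ⊕ (x ⊕ y) ≈ y
    lem y = ≈-trans (≈-sym (⊕-assoc (⊖ x) x y)) (≈-trans (⊕-congʳ (inverseˡ x)) (⊕-identityˡ y))

  ⊕-cancelʳ-≼ : ∀ x {y z} → y ⊕ x ≼ z ⊕ x → y ≼ z
  ⊕-cancelʳ-≼ x {y} {z} le = ⊕-cancelˡ-≼ x (begin
    x ⊕ y ≈⟨ ⊕-comm x y ⟩
    y ⊕ x ≤⟨ le ⟩
    z ⊕ x ≈⟨ ⊕-comm z x ⟩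
    x ⊕ z ∎)

  ⊕-cancelˡ-≈ : ∀ x {y z} → x ⊕ y ≈ x ⊕ z → y ≈ z
  ⊕-cancelˡ-≈ x eq = ≼-antisym (⊕-cancelˡ-≼ x (≼-reflexive eq)) (⊕-cancelˡ-≼ x (≼-reflexive (≈-sym eq)))

  x⊕[y⊖x]≈y : ∀ x y → x ⊕ (y ⊕ ⊖ x) ≈ y
  x⊕[y⊖x]≈y x y = begin-equality
    x ⊕ (y ⊕ ⊖ x)  ≈⟨ solve 3 (λ x y z → (x :+ (y :+ z)) ⊜ (y :+ (x :+ z))) ≈-refl x y (⊖ x) ⟩
    y ⊕ (x ⊕ ⊖ x)  ≈⟨ ⊕-congˡ (inverseʳ x) ⟩
    y ⊕ 0#         ≈⟨ ⊕-identityʳ y ⟩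
    y              ∎

  x≼x⊕y : ∀ x {y} → 0# ≼ y → x ≼ x ⊕ y
  x≼x⊕y x {y} 0≼y = begin
    x      ≈⟨ ⊕-identityʳ x ⟨
    x ⊕ 0# ≤⟨ ⊕-monoʳ-≼ x 0≼y ⟩
    x ⊕ y  ∎

  x≼y⊕x : ∀ x {y} → 0# ≼ y → x ≼ y ⊕ x
  x≼y⊕x x {y} 0≼y = ≼-trans (x≼x⊕y x 0≼y) (≼-reflexive (⊕-comm x y))

  0≼⋆ : ∀ n {x} → 0# ≼ x → 0# ≼ n ⋆ x
  0≼⋆ zero    0≼x = ≼-refl
  0≼⋆ (suc n) 0≼x = ≼-trans 0≼x (x≼x⊕y _ (0≼⋆ n 0≼x))

  0≼#1 : ∀ n → 0# ≼ n #1
  0≼#1 n = 0≼⋆ n 0≼1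

  ⋆-monoˡ-≼ : ∀ {x} → 0# ≼ x → ∀ {m n} → m ℕ.≤ n → m ⋆ x ≼ n ⋆ x
  ⋆-monoˡ-≼ 0≼x {n = n} z≤n   = 0≼⋆ n 0≼x
  ⋆-monoˡ-≼ {x} 0≼x (s≤s m≤n) = ⊕-monoʳ-≼ x (⋆-monoˡ-≼ 0≼x m≤n)

  #1-mono : ∀ {m n} → m ℕ.≤ n → m #1 ≼ n #1
  #1-mono = ⋆-monoˡ-≼ 0≼1

  #1-homo : ∀ m n → (m ℕ.+ n) #1 ≈ m #1 ⊕ n #1
  #1-homo = ×-homo-+ monoid 1#

  argmin : ∀ {k} → Fin k → (f : Fin k → Carrier) → ∃[ i ] (∀ j → f i ≼ f j)
  argmin {suc zero}    _ f = Fin.zero , λ { Fin.zero → ≼-refl }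
  argmin {suc (suc k)} _ f with argmin Fin.zero (f ∘ Fin.suc)
  ... | i , least with ≼-total (f Fin.zero) (f (Fin.suc i))
  ...   | inj₁ le = Fin.zero , λ { Fin.zero → ≼-refl ; (Fin.suc j) → ≼-trans le (least j) }
  ...   | inj₂ ge = Fin.suc i , λ { Fin.zero → ge ; (Fin.suc j) → least j }

  x≼y⇒0≼y⊖x : ∀ x y → x ≼ y → 0# ≼ y ⊕ ⊖ x
  x≼y⇒0≼y⊖x x y x≼y = begin
    0#       ≈⟨ inverseʳ x ⟨
    x ⊕ ⊖ x  ≤⟨ ⊕-monoˡ-≼ (⊖ x) x≼y ⟩
    y ⊕ ⊖ x  ∎

  0≼y⊖x⇒x≼y : ∀ x y → 0# ≼ y ⊕ ⊖ x → x ≼ y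
  0≼y⊖x⇒x≼y x y 0≼ = begin
    x              ≤⟨ x≼x⊕y x 0≼ ⟩
    x ⊕ (y ⊕ ⊖ x)  ≈⟨ x⊕[y⊖x]≈y x y ⟩
    y              ∎

  x≼y≼x⇒y⊖x≈0 : ∀ x y → x ≼ y → y ≼ x → y ⊕ ⊖ x ≈ 0#
  x≼y≼x⇒y⊖x≈0 x y x≼y y≼x = ≈-trans (⊕-congʳ (≼-antisym y≼x x≼y)) (inverseʳ x)

module _ where
  open Real

  ℝ-orderedAbelianGroup : ExcludedMiddle 0ℓ → OrderedAbelianGroup
  ℝ-orderedAbelianGroup em = record
    { abelianGroup = record
      { Carrier = ℝ ; _≈_ = _≃_ ; _∙_ = _+_ ; ε = 0ℝ ; _⁻¹ = -_
      ; isAbelianGroup = record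
        { isGroup = record
          { isMonoid = record
            { isSemigroup = record
              { isMagma = record
                { isEquivalence = ≃-isEquivalence
                ; ∙-cong = λ {x} {y} {u} {v} → +-cong x y u v }
              ; assoc = λ x y z → ≃-ptw (x + y + z) (x + (y + z)) λ n → ℚ.+-assoc (seq x n) (seq y n) (seq z n) }
            ; identity = (λ x → ≃-ptw (0ℝ + x) x λ n → ℚ.+-identityˡ (seq x n))
                       , (λ x → ≃-ptw (x + 0ℝ) x λ n → ℚ.+-identityʳ (seq x n)) }
          ; inverse = (λ x → ≃-ptw (- x + x) 0ℝ λ n → ℚ.+-inverseˡ (seq x n))
                    , (λ x → ≃-ptw (x - x) 0ℝ λ n → ℚ.+-inverseʳ (seq x n))
          ; ⁻¹-cong = λ {x} {y} → neg-cong x y }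
        ; comm = λ x y → ≃-ptw (x + y) (y + x) λ n → ℚ.+-comm (seq x n) (seq y n) } }
    ; _≼_ = _≤_
    ; isTotalOrder = record
      { isPartialOrder = record
        { isPreorder = record
          { isEquivalence = ≃-isEquivalence
          ; reflexive = λ {x} {y} → ≃⇒≤ x y
          ; trans = λ {x} {y} {z} → ≤-trans x y z }
        ; antisym = λ {x} {y} → ≤-antisym x y }
      ; total = ≤-total em }
    ; ⊕-monoʳ-≼ = λ x {y} {z} → +-mono-≤ x x y z (≤-ptw x x λ _ → ℚ.≤-refl)
    ; 1# = 1ℝ
    ; 0≼1 = ≤-ptw 0ℝ 1ℝ λ _ → ℚ.<⇒≤ (ℚ.positive⁻¹ 1ℚ)
    }
    where
    open import Relation.Binary.Structures using (IsEquivalence)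
    ≃-isEquivalence : IsEquivalence _≃_
    ≃-isEquivalence = record
      { refl = λ {x} → ≃-refl x ; sym = λ {x} {y} → ≃-sym x y ; trans = λ {x} {y} {z} → ≃-trans x y z }

-- Pairwise different edges on a cycle

infix 4 _≋_

_≋_ : ∀ {A : Set} → List A → List A → Set
xs ≋ ys = xs ⊆ ys × ys ⊆ xs

unique-map : ∀ {A B : Set} (f : A → B) {xs} → (∀ {x y} → x ∈ xs → y ∈ xs → f x ≡ f y → x ≡ y) →
  Unique xs → Unique (List.map f xs)
unique-map f inj []           = []
unique-map f inj (x∉xs ∷ xs!) =
  All.map⁺ (All.tabulate λ y∈xs fx≡fy → All.lookup x∉xs y∈xs (inj (here refl) (there y∈xs) fx≡fy))
  ∷ unique-map f (λ x∈ y∈ → inj (there x∈) (there y∈)) xs!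

-- Modulo `suc p`, adding `p * i` undoes the shift by `i`, since `p * i + i` is a multiple of
-- `suc p`. This avoids subtraction of naturals.
%-cancelˡ : ∀ p i {d d′} → d ℕ.< suc p → d′ ℕ.< suc p → (i ℕ.+ d) % suc p ≡ (i ℕ.+ d′) % suc p → d ≡ d′
%-cancelˡ p i {d} {d′} d<M d′<M eq =
  trans (sym (shifted d d<M)) (trans (cong (λ r → ((p ℕ.* i) % suc p ℕ.+ r) % suc p) eq) (shifted d′ d′<M))
  where
  arith : ∀ p i d → p ℕ.* i ℕ.+ (i ℕ.+ d) ≡ d ℕ.+ i ℕ.* suc p
  arith = solve 3 (λ p i d → p :* i :+ (i :+ d) := d :+ i :* (con 1 :+ p)) refl
    where open ℕ-Solver
  shifted : ∀ d → d ℕ.< suc p → ((p ℕ.* i) % suc p ℕ.+ (i ℕ.+ d) % suc p) % suc p ≡ d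
  shifted d d<M = trans (sym (ℕ.%-distribˡ-+ (p ℕ.* i) (i ℕ.+ d) (suc p)))
    (trans (cong (_% suc p) (arith p i d)) (trans (ℕ.[m+kn]%n≡m%n d i (suc p)) (ℕ.m<n⇒m%n≡m d<M)))

%-assoc-+ : ∀ p i d d′ → ((i ℕ.+ d) % suc p ℕ.+ d′) % suc p ≡ (i ℕ.+ (d ℕ.+ d′)) % suc p
%-assoc-+ p i d d′ = trans (ℕ.%-distribˡ-+ ((i ℕ.+ d) % suc p) d′ (suc p))
  (trans (cong (λ r → (r ℕ.+ d′ % suc p) % suc p) (ℕ.m%n%n≡m%n (i ℕ.+ d) (suc p)))
  (trans (sym (ℕ.%-distribˡ-+ (i ℕ.+ d) d′ (suc p))) (cong (_% suc p) (ℕ.+-assoc i d d′))))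

-- The sets block i j, for i ≤ p and j ≤ K, are subsets of a cycle of length
-- suc p, whose point 0 is the old vertex a and whose other points are the new
-- vertices n, …, n + p - 1.  They have i as their first point, the shift of i by
-- suc j as a mark, and r - 2 points beyond all possible marks as padding; if the
-- cycle is long compared with K + r, then i and j can be read off the set.
module Blocks (n a p K : ℕ) (a<n : a ℕ.< n) where

  vertex : ℕ → ℕ
  vertex zero    = a
  vertex (suc i) = i ℕ.+ n

  vertex-injective : ∀ {i j} → vertex i ≡ vertex j → i ≡ j
  vertex-injective {zero}  {zero}  _  = refl
  vertex-injective {zero}  {suc j} eq = contradiction (subst (ℕ._< n) eq a<n) (ℕ.m+n≮n j n)
  vertex-injective {suc i} {zero}  eq = contradiction (subst (ℕ._< n) (sym eq) a<n) (ℕ.m+n≮n i n)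
  vertex-injective {suc i} {suc j} eq = cong suc (ℕ.+-cancelʳ-≡ n i j eq)

  vertex< : ∀ {i} → i ℕ.< suc p → vertex i ℕ.< n ℕ.+ p
  vertex< {zero}  _         = ℕ.m≤n⇒m≤n+o p a<n
  vertex< {suc i} (s≤s i<p) = subst (ℕ._≤ n ℕ.+ p) (ℕ.+-comm n (suc i)) (ℕ.+-monoʳ-≤ n i<p)

  offsets : ℕ → ℕ → List ℕ
  -- The marks run from 1 to `K + 1` because `j ≤ K`, so the padding begins at `2 + K`.
  offsets r j = 0 ∷ suc j ∷ applyUpTo (ℕ._+ (2 ℕ.+ K)) (r ∸ 2)

  width : ℕ → ℕ
  width r = (r ∸ 2) ℕ.+ (2 ℕ.+ K)

  block : ℕ → ℕ → ℕ → List ℕ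
  block r i j = List.map (λ d → vertex ((i ℕ.+ d) % suc p)) (offsets r j)

  block-length : ∀ {r} i j → 2 ℕ.≤ r → length (block r i j) ≡ r
  block-length {r} i j 2≤r = trans (List.length-map _ (offsets r j))
    (trans (cong (2 ℕ.+_) (List.length-applyUpTo _ (r ∸ 2))) (ℕ.m+[n∸m]≡n 2≤r))

  padding≢mark : ∀ t {j} → j ℕ.≤ K → suc j ≢ t ℕ.+ (2 ℕ.+ K)
  padding≢mark t {j} j≤K eq = ℕ.<⇒≢ (ℕ.≤-trans (s≤s (s≤s j≤K)) (ℕ.m≤n+m (2 ℕ.+ K) t)) eq

  offsets-unique : ∀ r {j} → j ℕ.≤ K → Unique (offsets r j)
  offsets-unique r {j} j≤K =
    ((λ ()) ∷ All.applyUpTo⁺₂ _ (r ∸ 2) λ t eq → ℕ.0≢1+n (trans eq (ℕ.+-suc t (suc K))))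
    ∷ All.applyUpTo⁺₂ _ (r ∸ 2) (λ t → padding≢mark t j≤K)
    ∷ Unique.applyUpTo⁺₁ _ (r ∸ 2) λ {i} {k} i<k _ eq → ℕ.<⇒≢ i<k (ℕ.+-cancelʳ-≡ (2 ℕ.+ K) i k eq)

  offset< : ∀ r {j d} → j ℕ.≤ K → d ∈ offsets r j → d ℕ.< width r
  offset< r j≤K (here refl)         = subst (0 ℕ.<_) (sym (ℕ.+-suc (r ∸ 2) (suc K))) (s≤s z≤n)
  offset< r {j} j≤K (there (here refl)) = ℕ.≤-trans (s≤s (s≤s j≤K)) (ℕ.m≤n+m (2 ℕ.+ K) (r ∸ 2))
  offset< r j≤K (there (there d∈)) with ∈.∈-applyUpTo⁻ _ d∈
  ... | t , t< , refl = ℕ.+-monoˡ-< (2 ℕ.+ K) t<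

  module _ (r : ℕ) (long : width r ℕ.+ width r ℕ.< suc p) where

    width< : width r ℕ.< suc p
    width< = ℕ.≤-<-trans (ℕ.m≤m+n (width r) (width r)) long

    offset<suc-p : ∀ {j d} → j ℕ.≤ K → d ∈ offsets r j → d ℕ.< suc p
    offset<suc-p j≤K d∈ = ℕ.<-trans (offset< r j≤K d∈) width<

    block-unique : ∀ i {j} → j ℕ.≤ K → Unique (block r i j)
    block-unique i j≤K = unique-map _
      (λ d∈ d′∈ eq → %-cancelˡ p i (offset<suc-p j≤K d∈) (offset<suc-p j≤K d′∈) (vertex-injective eq))
      (offsets-unique r j≤K)

    block-bound : ∀ i j → All (ℕ._< n ℕ.+ p) (block r i j)
    block-bound i j = All.map⁺ (All.tabulate λ {d} _ → vertex< (ℕ.m%n<n (i ℕ.+ d) (suc p)))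

    first∈block : ∀ {i} j → i ℕ.< suc p → vertex i ∈ block r i j
    first∈block {i} j i<M = here (cong vertex (sym (trans (cong (_% suc p) (ℕ.+-identityʳ i)) (ℕ.m<n⇒m%n≡m i<M))))

    -- The mark belonging to `j = 0` is the offset 1. For this reason the index 0 is reserved for
    -- the edge that spills over to the next vertex.
    next∈block : ∀ {i} → suc i ℕ.< suc p → vertex (suc i) ∈ block r i 0
    next∈block {i} 1+i<M = there (here (cong vertex
      (sym (trans (cong (_% suc p) (ℕ.+-comm i 1)) (ℕ.m<n⇒m%n≡m 1+i<M)))))

    -- The point 0 is the only old vertex on the cycle, and the first point and the mark cannot both
    -- be it.
    block-new : ∀ i {j} → j ℕ.≤ K → ∃[ x ] (x ∈ block r i j × n ℕ.≤ x)
    block-new i {j} j≤K with (i ℕ.+ 0) % suc p in eq₀ | (i ℕ.+ suc j) % suc p in eq₁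
    ... | suc k | _     = _ , here refl , ℕ.m≤n+m n k
    ... | zero  | suc k = _ , there (here refl) , ℕ.m≤n+m n k
    ... | zero  | zero  = contradiction
      (%-cancelˡ p i (s≤s z≤n) (offset<suc-p j≤K (there (here refl))) (trans eq₀ (sym eq₁))) λ ()

    ∈block⁻ : ∀ i′ {j′ x} i d → vertex ((i ℕ.+ d) % suc p) ≡ x → x ∈ block r i′ j′ →
      ∃[ d′ ] (d′ ∈ offsets r j′ × (i ℕ.+ d) % suc p ≡ (i′ ℕ.+ d′) % suc p)
    ∈block⁻ i′ i d refl x∈ with ∈.∈-map⁻ _ x∈
    ... | d′ , d′∈ , eq = d′ , d′∈ , vertex-injective eq

    -- Each first point is an offset away from the other, say by `d′` one way and `d` back, so
    -- `d + d′` vanishes modulo `suc p`. Both offsets are below `width r`, and a cycle longer than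
    -- twice that width leaves only `d + d′ = 0`. This is why `long` asks for two widths.
    block-first : ∀ {i i′ j j′} → i ℕ.< suc p → i′ ℕ.< suc p → j ℕ.≤ K → j′ ℕ.≤ K →
      block r i j ≋ block r i′ j′ → i ≡ i′
    block-first {i} {i′} i<M i′<M j≤K j′≤K (sub , sup)
      with ∈block⁻ i′ i 0 refl (sub (here refl)) | ∈block⁻ i i′ 0 refl (sup (here refl))
    ... | d′ , d′∈ , eq | d , d∈ , eq′ = trans (sym i%M) (trans eq (trans (cong (λ e → (i′ ℕ.+ e) % suc p) d′≡0) i′%M))
      where
      i%M : (i ℕ.+ 0) % suc p ≡ i
      i%M = trans (cong (_% suc p) (ℕ.+-identityʳ i)) (ℕ.m<n⇒m%n≡m i<M)
      i′%M : (i′ ℕ.+ 0) % suc p ≡ i′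
      i′%M = trans (cong (_% suc p) (ℕ.+-identityʳ i′)) (ℕ.m<n⇒m%n≡m i′<M)
      d+d′<M : d ℕ.+ d′ ℕ.< suc p
      d+d′<M = ℕ.<-trans (ℕ.+-mono-< (offset< r j≤K d∈) (offset< r j′≤K d′∈)) long
      d+d′≡0 : d ℕ.+ d′ ≡ 0
      d+d′≡0 = %-cancelˡ p i d+d′<M (s≤s z≤n) (trans (sym (%-assoc-+ p i d d′))
        (trans (cong (λ e → (e ℕ.+ d′) % suc p) (trans (sym eq′) i′%M)) (sym eq)))
      d′≡0 : d′ ≡ 0
      d′≡0 = ℕ.m+n≡0⇒n≡0 d d+d′≡0

    -- With a common first point, the mark of one block is an offset of the other. It is not 0 and
    -- too small to be padding, so it is the other mark.
    block-mark : ∀ i {j j′} → j ℕ.≤ K → j′ ℕ.≤ K → block r i j ⊆ block r i j′ → j ≡ j′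
    block-mark i {j} j≤K j′≤K sub with ∈block⁻ i i (suc j) refl (sub (there (here refl)))
    ... | d′ , d′∈ , eq with %-cancelˡ p i (offset<suc-p {j} j≤K (there (here refl))) (offset<suc-p j′≤K d′∈) eq
    block-mark i j≤K j′≤K sub | _ , there (here refl) , eq | refl = refl
    block-mark i j≤K j′≤K sub | _ , there (there d′∈) , eq | refl with ∈.∈-applyUpTo⁻ _ d′∈
    ... | t , _ , mark≡ = contradiction mark≡ (padding≢mark t j≤K)

    block-injective : ∀ {i i′ j j′} → i ℕ.< suc p → i′ ℕ.< suc p → j ℕ.≤ K → j′ ℕ.≤ K →
      block r i j ≋ block r i′ j′ → (i , j) ≡ (i′ , j′)
    block-injective {i} i<M i′<M j≤K j′≤K eq with block-first i<M i′<M j≤K j′≤K eq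
    ... | refl = cong (i ,_) (block-mark i j≤K j′≤K (proj₁ eq))

-- Regions, loads and the charging of edges to vertices

-- The vertices of a structure with n elements are the naturals below n, so that
-- extensions keep the names of old vertices.  Only the part below n of a region
-- matters.
Region : Set
Region = ℕ → Bool

⟦_⟧ : Bool → ℕ
⟦ b ⟧ = if b then 1 else 0

-- The start `k` is a parameter because charging moves along the new vertices and needs the count of
-- those still ahead.
count : Region → ℕ → ℕ → ℕ
count T k zero    = 0
count T k (suc u) = ⟦ T k ⟧ ℕ.+ count T (suc k) u

covers : Region → List ℕ → Bool
covers T []       = true
covers T (x ∷ xs) = T x ∧ covers T xs

covers⁻ : ∀ (T : Region) {xs x} → covers T xs ≡ true → x ∈ xs → T x ≡ true
covers⁻ T {x ∷ xs} eq (here refl) = Bool.∧-conicalˡ _ _ eq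
covers⁻ T {x ∷ xs} eq (there x∈)  = covers⁻ T (Bool.∧-conicalʳ (T x) _ eq) x∈

covers⁺ : ∀ (T : Region) xs → (∀ {x} → x ∈ xs → T x ≡ true) → covers T xs ≡ true
covers⁺ T []       f = refl
covers⁺ T (x ∷ xs) f = cong₂ _∧_ (f (here refl)) (covers⁺ T xs (f ∘ there))

module Load (G : OrderedAbelianGroup) (L : Language)
            (α : Symbol L → OrderedAbelianGroup.Carrier G) where
  open OrderedAbelianGroup G
  open OrderedAbelianGroupProperties G

  Edge : Set
  Edge = Symbol L × List ℕ

  ind : Bool → Carrier → Carrier
  ind b x = if b then x else 0#

  load : Region → List Edge → Carrier
  load T []             = 0#
  load T ((E , X) ∷ es) = ind (covers T X) (α E) ⊕ load T es

  weight : List (Symbol L) → Carrier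
  weight []       = 0#
  weight (E ∷ Es) = α E ⊕ weight Es

  0≼ind : ∀ b {x} → 0# ≼ x → 0# ≼ ind b x
  0≼ind true  0≼x = 0≼x
  0≼ind false _   = ≼-refl

  ind-mono : ∀ b {x y} → x ≼ y → ind b x ≼ ind b y
  ind-mono true  x≼y = x≼y
  ind-mono false _   = ≼-refl

module Charging (em : ExcludedMiddle 0ℓ) (G : OrderedAbelianGroup) (L : Language)
         (α : Symbol L → OrderedAbelianGroup.Carrier G) where
  open OrderedAbelianGroup G
  open OrderedAbelianGroupProperties G
  open Load G L α
  open ≼-Reasoning

  -- Since every weight is at least `ε`, at most `K` edges fit into a capacity of 1. Together with
  -- one edge that spills over, at most `K + 1` edges begin at a vertex, which is the number of
  -- marks that blocks provide.
  record Params : Set where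
    field
      ε    : Carrier
      ε≰0  : ¬ (ε ≼ 0#)
      ε≼α  : ∀ E → ε ≼ α E
      α≼1  : ∀ E → α E ≼ 1#
      K    : ℕ
      1≼Kε : 1# ≼ K ⋆ ε

  -- One step of charging, for an edge paid by the current vertex alone; `b` tells whether the edge
  -- lies inside the region and `v` whether the vertex does. An edge inside the region takes the
  -- vertex with it, so the capacity drops from `s` to `s′` exactly when it may. Any other edge
  -- costs nothing, and `s′` is below `s` anyway.
  bound-here : ∀ b v {x l s s′ c} → 0# ≼ x → x ⊕ s′ ≈ s → (b ≡ true → v ≡ true) →
    l ≼ ind v s′ ⊕ c → ind b x ⊕ l ≼ ind v s ⊕ c
  bound-here true v {x} {l} {s} {s′} {c} 0≼x eq v-true l≼ rewrite v-true refl = begin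
    x ⊕ l        ≤⟨ ⊕-monoʳ-≼ x l≼ ⟩
    x ⊕ (s′ ⊕ c) ≈⟨ ⊕-assoc x s′ c ⟨
    x ⊕ s′ ⊕ c   ≈⟨ ⊕-congʳ eq ⟩
    s ⊕ c        ∎
  bound-here false v {x} {l} {s} {s′} {c} 0≼x eq v-true l≼ = begin
    0# ⊕ l       ≈⟨ ⊕-identityˡ l ⟩
    l            ≤⟨ l≼ ⟩
    ind v s′ ⊕ c ≤⟨ ⊕-monoˡ-≼ c (ind-mono v (≼-trans (x≼y⊕x s′ 0≼x) (≼-reflexive eq))) ⟩
    ind v s ⊕ c  ∎

  -- The same step for an edge that exhausts the current vertex and takes the rest from the next
  -- one, whose membership is `w`. If the edge is not inside the region, the remainder `s′` of the
  -- next vertex is estimated by its full capacity 1.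
  bound-next : ∀ b v w {x l s s′ c} → 0# ≼ s → s′ ≼ 1# → x ⊕ s′ ≈ s ⊕ 1# →
    (b ≡ true → v ≡ true × w ≡ true) →
    l ≼ ind w s′ ⊕ c #1 → ind b x ⊕ l ≼ ind v s ⊕ (⟦ w ⟧ ℕ.+ c) #1
  bound-next true v w {x} {l} {s} {s′} {c} 0≼s s′≼1 eq vw-true l≼
    rewrite proj₁ (vw-true refl) | proj₂ (vw-true refl) = begin
      x ⊕ l            ≤⟨ ⊕-monoʳ-≼ x l≼ ⟩
      x ⊕ (s′ ⊕ c #1)  ≈⟨ ⊕-assoc x s′ (c #1) ⟨
      x ⊕ s′ ⊕ c #1    ≈⟨ ⊕-congʳ eq ⟩
      s ⊕ 1# ⊕ c #1    ≈⟨ ⊕-assoc s 1# (c #1) ⟩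
      s ⊕ (1# ⊕ c #1)  ∎
  bound-next false v w {x} {l} {s} {s′} {c} 0≼s s′≼1 eq vw-true l≼ = begin
    0# ⊕ l                        ≈⟨ ⊕-identityˡ l ⟩
    l                             ≤⟨ l≼ ⟩
    ind w s′ ⊕ c #1               ≤⟨ ⊕-monoˡ-≼ (c #1) (fresh w) ⟩
    ⟦ w ⟧ #1 ⊕ c #1               ≈⟨ #1-homo ⟦ w ⟧ c ⟨
    (⟦ w ⟧ ℕ.+ c) #1              ≤⟨ x≼y⊕x _ (0≼ind v 0≼s) ⟩
    ind v s ⊕ (⟦ w ⟧ ℕ.+ c) #1    ∎
    where
    fresh : ∀ w → ind w s′ ≼ ⟦ w ⟧ #1
    fresh true  = ≼-trans s′≼1 (x≼x⊕y 1# ≼-refl)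
    fresh false = ≼-refl

  module Weights (P : Params) where
    open Params P

    0≼α : ∀ E → 0# ≼ α E
    0≼α E = ≼-trans ([ (λ ε≼0 → contradiction ε≼0 ε≰0) , (λ 0≼ε → 0≼ε) ]′ (≼-total ε 0#)) (ε≼α E)

    0≼weight : ∀ Es → 0# ≼ weight Es
    0≼weight []       = ≼-refl
    0≼weight (E ∷ Es) = ≼-trans (0≼α E) (x≼x⊕y (α E) (0≼weight Es))

    module Cycle (n a p : ℕ) (a<n : a ℕ.< n)
      (long : ∀ E → Blocks.width n a p K a<n (arity L E) ℕ.+ Blocks.width n a p K a<n (arity L E) ℕ.< suc p) where
      open Blocks n a p K a<n

      Key : Set
      Key = Symbol L × ℕ × ℕ

      edge : Key → Edge
      edge (E , i , j) = E , block (arity L E) i j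

      -- Keys are handed out with ascending positions and, at one position, descending marks. This
      -- bounds all keys still to come and so separates them from those already used.
      From : ℕ → ℕ → Key → Set
      From i t (_ , i′ , j) = i ℕ.< i′ ⊎ (i ≡ i′ × j ℕ.≤ t)

      record Placement (i t : ℕ) (s : Carrier) (u : ℕ) (Es : List (Symbol L)) : Set where
        field
          keys     : List Key
          labels   : List.map proj₁ keys ≡ Es
          inRange  : All (λ (_ , i′ , j) → i′ ℕ.< suc p × j ℕ.≤ K) keys
          from     : All (From i t) keys
          distinct : AllPairs (λ k k′ → proj₂ k ≢ proj₂ k′) keys
          -- Edges inside `T` are charged to vertices of `T` only, so they weigh at most the
          -- capacity that `T` still has. The vertices after position `i` are numbered from `i + n`,
          -- which is `vertex (suc i)`.
          bound    : ∀ T → load T (List.map edge keys) ≼ ind (T (vertex i)) s ⊕ count T (i ℕ.+ n) u #1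

      -- At position i the vertex still has to receive weight s, and the u later
      -- vertices of the cycle have to receive weight 1 each.  An edge of weight at
      -- most s is charged to the current vertex; a heavier one uses up s, and its
      -- remaining weight is charged to the next vertex.
      distribute : ∀ Es i t s u → i ℕ.+ u ≡ p → t ℕ.≤ K → 0# ≼ s → s ≼ t ⋆ ε →
        weight Es ≈ s ⊕ u #1 → Placement i t s u Es
      distribute [] i t s u i+u≡p t≤K 0≼s s≼tε eq = record
        { keys = [] ; labels = refl ; inRange = [] ; from = [] ; distinct = []
        ; bound = λ T → ≼-trans (0≼ind (T (vertex i)) 0≼s) (x≼x⊕y _ (0≼#1 (count T (i ℕ.+ n) u))) }
      distribute (E ∷ Es) i t s u i+u≡p t≤K 0≼s s≼tε eq with em {α E ≼ s}
      -- The marks cannot run out: with `t = 0` the remaining capacity is at most `0#`, and every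
      -- edge weighs at least `ε`.
      distribute (E ∷ Es) i zero s u i+u≡p t≤K 0≼s s≼tε eq | yes α≼s =
        contradiction (≼-trans (ε≼α E) (≼-trans α≼s s≼tε)) ε≰0
      distribute (E ∷ Es) i (suc t) s u i+u≡p t<K 0≼s s≼tε eq | yes α≼s = record
        { keys     = (E , i , suc t) ∷ P.keys
        ; labels   = cong (E ∷_) P.labels
        ; inRange  = (i<M , t<K) ∷ P.inRange
        ; from     = inj₂ (refl , ℕ.≤-refl) ∷ All.map (λ {k} → weaken {k}) P.from
        ; distinct = All.map (λ {k} → separate {k}) P.from ∷ P.distinct
        ; bound    = λ T → bound-here (covers T (block (arity L E) i (suc t))) (T (vertex i)) (0≼α E) (x⊕[y⊖x]≈y (α E) s)
            (λ inside → covers⁻ T inside (first∈block (arity L E) (long E) (suc t) i<M)) (P.bound T)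
        }
        where
        s′ = s ⊕ ⊖ α E
        i<M : i ℕ.< suc p
        i<M = s≤s (subst (i ℕ.≤_) i+u≡p (ℕ.m≤m+n i u))
        0≼s′ : 0# ≼ s′
        0≼s′ = ⊕-cancelˡ-≼ (α E) (begin
          α E ⊕ 0# ≈⟨ ⊕-identityʳ (α E) ⟩
          α E      ≤⟨ α≼s ⟩
          s        ≈⟨ x⊕[y⊖x]≈y (α E) s ⟨
          α E ⊕ s′ ∎)
        s′≼tε : s′ ≼ t ⋆ ε
        s′≼tε = ⊕-cancelˡ-≼ ε (begin
          ε ⊕ s′     ≤⟨ ⊕-monoˡ-≼ s′ (ε≼α E) ⟩
          α E ⊕ s′   ≈⟨ x⊕[y⊖x]≈y (α E) s ⟩
          s          ≤⟨ s≼tε ⟩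
          ε ⊕ t ⋆ ε  ∎)
        eq′ : weight Es ≈ s′ ⊕ u #1
        eq′ = ⊕-cancelˡ-≈ (α E) (begin-equality
          α E ⊕ weight Es     ≈⟨ eq ⟩
          s ⊕ u #1            ≈⟨ ⊕-congʳ (x⊕[y⊖x]≈y (α E) s) ⟨
          α E ⊕ s′ ⊕ u #1     ≈⟨ ⊕-assoc (α E) s′ (u #1) ⟩
          α E ⊕ (s′ ⊕ u #1)   ∎)
        module P = Placement (distribute Es i t s′ u i+u≡p (ℕ.≤-trans (ℕ.n≤1+n t) t<K) 0≼s′ s′≼tε eq′)
        weaken : ∀ {k} → From i t k → From i (suc t) k
        weaken (inj₁ i<i′)       = inj₁ i<i′
        weaken (inj₂ (eq , j≤t)) = inj₂ (eq , ℕ.m≤n⇒m≤1+n j≤t)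
        separate : ∀ {k} → From i t k → (i , suc t) ≢ proj₂ k
        separate (inj₁ i<i) refl        = ℕ.<-irrefl refl i<i
        separate (inj₂ (_ , t<t)) refl = ℕ.<-irrefl refl t<t
      -- At the last vertex the remaining weight equals the remaining capacity, so no edge can
      -- exceed it.
      distribute (E ∷ Es) i t s zero i+u≡p t≤K 0≼s s≼tε eq | no α⋠s =
        contradiction (begin
          α E              ≤⟨ x≼x⊕y (α E) (0≼weight Es) ⟩
          α E ⊕ weight Es  ≈⟨ eq ⟩
          s ⊕ 0#           ≈⟨ ⊕-identityʳ s ⟩
          s                ∎) α⋠s
      distribute (E ∷ Es) i t s (suc u) i+u≡p t≤K 0≼s s≼tε eq | no α⋠s = record
        { keys     = (E , i , 0) ∷ P.keys
        ; labels   = cong (E ∷_) P.labels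
        ; inRange  = (ℕ.<-trans (ℕ.n<1+n i) 1+i<M , z≤n) ∷ P.inRange
        ; from     = inj₂ (refl , z≤n) ∷ All.map (λ {k} f → inj₁ (beyond {k} f)) P.from
        ; distinct = All.map (λ {k} f eq → ℕ.<⇒≢ (beyond {k} f) (cong proj₁ eq)) P.from ∷ P.distinct
        ; bound    = λ T → bound-next (covers T (block (arity L E) i 0)) (T (vertex i)) (T (i ℕ.+ n)) 0≼s s′≼1
            (x⊕[y⊖x]≈y (α E) (s ⊕ 1#))
            (λ inside → covers⁻ T inside (first∈block (arity L E) (long E) 0 (ℕ.<-trans (ℕ.n<1+n i) 1+i<M))
                      , covers⁻ T inside (next∈block (arity L E) (long E) 1+i<M)) (P.bound T)
        }
        where
        s′ = s ⊕ 1# ⊕ ⊖ α E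
        s≼α : s ≼ α E
        s≼α = [ (λ s≼α → s≼α) , (λ α≼s → contradiction α≼s α⋠s) ]′ (≼-total s (α E))
        1+i+u≡p : suc i ℕ.+ u ≡ p
        1+i+u≡p = trans (sym (ℕ.+-suc i u)) i+u≡p
        1+i<M : suc i ℕ.< suc p
        1+i<M = s≤s (subst (suc i ℕ.≤_) 1+i+u≡p (ℕ.m≤m+n (suc i) u))
        0≼s′ : 0# ≼ s′
        0≼s′ = ⊕-cancelˡ-≼ (α E) (begin
          α E ⊕ 0#  ≈⟨ ⊕-identityʳ (α E) ⟩
          α E       ≤⟨ α≼1 E ⟩
          1#        ≤⟨ x≼y⊕x 1# 0≼s ⟩
          s ⊕ 1#    ≈⟨ x⊕[y⊖x]≈y (α E) (s ⊕ 1#) ⟨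
          α E ⊕ s′  ∎)
        s′≼1 : s′ ≼ 1#
        s′≼1 = ⊕-cancelˡ-≼ (α E) (begin
          α E ⊕ s′  ≈⟨ x⊕[y⊖x]≈y (α E) (s ⊕ 1#) ⟩
          s ⊕ 1#    ≤⟨ ⊕-monoˡ-≼ 1# s≼α ⟩
          α E ⊕ 1#  ∎)
        eq′ : weight Es ≈ s′ ⊕ u #1
        eq′ = ⊕-cancelˡ-≈ (α E) (begin-equality
          α E ⊕ weight Es     ≈⟨ eq ⟩
          s ⊕ (1# ⊕ u #1)     ≈⟨ ⊕-assoc s 1# (u #1) ⟨
          s ⊕ 1# ⊕ u #1       ≈⟨ ⊕-congʳ (x⊕[y⊖x]≈y (α E) (s ⊕ 1#)) ⟨
          α E ⊕ s′ ⊕ u #1     ≈⟨ ⊕-assoc (α E) s′ (u #1) ⟩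
          α E ⊕ (s′ ⊕ u #1)   ∎)
        -- A new vertex starts again with all marks: its capacity is at most 1, hence at most
        -- `K ⋆ ε`.
        module P = Placement (distribute Es (suc i) K s′ u 1+i+u≡p ℕ.≤-refl 0≼s′ (≼-trans s′≼1 1≼Kε) eq′)
        beyond : ∀ {k} → From (suc i) K k → i ℕ.< proj₁ (proj₂ k)
        beyond (inj₁ 1+i<i′)     = ℕ.<-trans (ℕ.n<1+n i) 1+i<i′
        beyond (inj₂ (refl , _)) = ℕ.n<1+n i

-- Boolean operations on regions and their counts

bounded : ∀ {k} (f : Fin k → ℕ) → ∃[ b ] (∀ i → f i ℕ.≤ b)
bounded {zero}  f = 0 , λ ()
bounded {suc k} f with bounded (f ∘ Fin.suc)
... | b , f≤b = f Fin.zero ℕ.⊔ b ,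
  λ { Fin.zero → ℕ.m≤m⊔n _ b ; (Fin.suc i) → ℕ.m≤n⇒m≤o⊔n (f Fin.zero) (f≤b i) }

AllPairs-map-All : ∀ {A : Set} {P : A → Set} {R S : A → A → Set} {xs} →
  (∀ {x y} → P x → P y → R x y → S x y) → All P xs → AllPairs R xs → AllPairs S xs
AllPairs-map-All f []         []         = []
AllPairs-map-All f (px ∷ pxs) (rx ∷ rxs) =
  All.zipWith (λ (py , r) → f px py r) (pxs , rx) ∷ AllPairs-map-All f pxs rxs

infixr 6 _∪_ _∩_

_∪_ _∩_ : Region → Region → Region
(T ∪ T′) x = T x ∨ T′ x
(T ∩ T′) x = T x ∧ T′ x

full : Region
full _ = true

infix 4 _≗[_]_
_≗[_]_ : Region → ℕ → Region → Set
T ≗[ n ] T′ = ∀ x → x ℕ.< n → T x ≡ T′ x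

count-cong : ∀ {T T′} k u → T ≗[ k ℕ.+ u ] T′ → count T k u ≡ count T′ k u
count-cong k zero    eq = refl
count-cong k (suc u) eq = cong₂ ℕ._+_ (cong ⟦_⟧ (eq k (ℕ.m<m+n k (s≤s z≤n))))
  (count-cong (suc k) u λ x x< → eq x (subst (x ℕ.<_) (sym (ℕ.+-suc k u)) x<))

count-+ : ∀ T k u v → count T k (u ℕ.+ v) ≡ count T k u ℕ.+ count T (k ℕ.+ u) v
count-+ T k zero    v = cong (λ l → count T l v) (sym (ℕ.+-identityʳ k))
count-+ T k (suc u) v = trans (cong (⟦ T k ⟧ ℕ.+_) (trans (count-+ T (suc k) u v)
    (cong (λ l → count T (suc k) u ℕ.+ count T l v) (sym (ℕ.+-suc k u)))))
  (sym (ℕ.+-assoc ⟦ T k ⟧ (count T (suc k) u) (count T (k ℕ.+ suc u) v)))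

count-∪-∩ : ∀ T T′ k u → count (T ∪ T′) k u ℕ.+ count (T ∩ T′) k u ≡ count T k u ℕ.+ count T′ k u
count-∪-∩ T T′ k zero    = refl
count-∪-∩ T T′ k (suc u) = trans (swap ⟦ (T ∪ T′) k ⟧ ⟦ (T ∩ T′) k ⟧ _ _)
  (trans (cong₂ ℕ._+_ (bits (T k) (T′ k)) (count-∪-∩ T T′ (suc k) u))
  (sym (swap ⟦ T k ⟧ ⟦ T′ k ⟧ _ _)))
  where
  swap : ∀ a b c d → (a ℕ.+ c) ℕ.+ (b ℕ.+ d) ≡ (a ℕ.+ b) ℕ.+ (c ℕ.+ d)
  swap = solve 4 (λ a b c d → (a :+ c) :+ (b :+ d) := (a :+ b) :+ (c :+ d)) refl
    where open ℕ-Solver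
  bits : ∀ b c → ⟦ b ∨ c ⟧ ℕ.+ ⟦ b ∧ c ⟧ ≡ ⟦ b ⟧ ℕ.+ ⟦ c ⟧
  bits false false = refl
  bits false true  = refl
  bits true  false = refl
  bits true  true  = refl

count-none : ∀ {T} k u → (∀ x → k ℕ.≤ x → T x ≡ false) → count T k u ≡ 0
count-none k zero    none = refl
count-none k (suc u) none = cong₂ ℕ._+_ (cong ⟦_⟧ (none k ℕ.≤-refl))
  (count-none (suc k) u λ x k<x → none x (ℕ.<⇒≤ k<x))

count-all : ∀ {T} k u → (∀ x → k ℕ.≤ x → T x ≡ true) → count T k u ≡ u
count-all k zero    every = refl
count-all k (suc u) every = cong₂ ℕ._+_ (cong ⟦_⟧ (every k ℕ.≤-refl))
  (count-all (suc k) u λ x k<x → every x (ℕ.<⇒≤ k<x))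

⟦⟧-mono : ∀ {b c} → (b ≡ true → c ≡ true) → ⟦ b ⟧ ℕ.≤ ⟦ c ⟧
⟦⟧-mono {false}     imp = z≤n
⟦⟧-mono {true}  {c} imp rewrite imp refl = ℕ.≤-refl

count-mono : ∀ {T T′} k u → (∀ x → T x ≡ true → T′ x ≡ true) → count T k u ℕ.≤ count T′ k u
count-mono k zero    imp = z≤n
count-mono k (suc u) imp = ℕ.+-mono-≤ (⟦⟧-mono (imp k)) (count-mono (suc k) u imp)

count-strict : ∀ {T T′ a} k u → (∀ x → T x ≡ true → T′ x ≡ true) → T a ≡ false → T′ a ≡ true →
  k ℕ.≤ a → a ℕ.< k ℕ.+ u → count T k u ℕ.< count T′ k u
count-strict {a = a} k zero imp ∉T ∈T′ k≤a a<k+0 =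
  contradiction (subst (a ℕ.<_) (ℕ.+-identityʳ k) a<k+0) (ℕ.≤⇒≯ k≤a)
count-strict {T} {T′} {a} k (suc u) imp ∉T ∈T′ k≤a a< with ℕ.m≤n⇒m<n∨m≡n k≤a
... | inj₁ k<a = ℕ.+-mono-≤-< (⟦⟧-mono (imp k))
  (count-strict (suc k) u imp ∉T ∈T′ k<a (subst (a ℕ.<_) (ℕ.+-suc k u) a<))
... | inj₂ refl rewrite ∉T | ∈T′ = s≤s (count-mono (suc k) u imp)

⁅_⁆ : ℕ → Region
⁅ a ⁆ x = does (x ℕ.≟ a)

count-⁅⁆ : ∀ a k u → count ⁅ a ⁆ k u ℕ.≤ 1
count-⁅⁆ a k zero    = z≤n
count-⁅⁆ a k (suc u) with k ℕ.≟ a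
... | no k≢a rewrite dec-false (k ℕ.≟ a) k≢a = count-⁅⁆ a (suc k) u
... | yes refl rewrite dec-true (k ℕ.≟ k) refl = ℕ.≤-reflexive (cong suc (count-none (suc k) u λ x k<x → dec-false (x ℕ.≟ k) (ℕ.>⇒≢ k<x)))

covers-cong : ∀ {n} {T T′} {X} → All (ℕ._< n) X → T ≗[ n ] T′ → covers T X ≡ covers T′ X
covers-cong []         eq = refl
covers-cong (x<n ∷ X<) eq = cong₂ _∧_ (eq _ x<n) (covers-cong X< eq)

covers-∪ˡ : ∀ T T′ X → covers T X ≡ true → covers (T ∪ T′) X ≡ true
covers-∪ˡ T T′ X eq = covers⁺ (T ∪ T′) X λ x∈ → cong (_∨ _) (covers⁻ T eq x∈)

covers-∪ʳ : ∀ T T′ X → covers T′ X ≡ true → covers (T ∪ T′) X ≡ true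
covers-∪ʳ T T′ X eq = covers⁺ (T ∪ T′) X λ {x} x∈ →
  trans (cong (T x ∨_) (covers⁻ T′ eq x∈)) (Bool.∨-zeroʳ (T x))

covers-∩ : ∀ T T′ X → covers T X ≡ true → covers T′ X ≡ true → covers (T ∩ T′) X ≡ true
covers-∩ T T′ X eq eq′ = covers⁺ (T ∩ T′) X λ x∈ → cong₂ _∧_ (covers⁻ T eq x∈) (covers⁻ T′ eq′ x∈)

-- Sparse hypergraphs and submodularity of the predimension

module Hypergraph (em : ExcludedMiddle 0ℓ) (G : OrderedAbelianGroup) (L : Language)
         (α : Symbol L → OrderedAbelianGroup.Carrier G)
         (0≼α : ∀ E → OrderedAbelianGroup._≼_ G (OrderedAbelianGroup.0# G) (α E)) where
  open OrderedAbelianGroup G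
  open OrderedAbelianGroupProperties G
  open Load G L α
  open ≼-Reasoning

  -- An edge is stored as one enumeration of its set. Comparing edges as sets in `apart` makes the
  -- load count every set once.
  record Valid (n : ℕ) (es : List Edge) : Set where
    field
      wellFormed : All (λ (E , X) → length X ≡ arity L E × Unique X × All (ℕ._< n) X) es
      apart      : AllPairs (λ e e′ → proj₁ e ≡ proj₁ e′ → ¬ proj₂ e ≋ proj₂ e′) es

    within : All (λ e → All (ℕ._< n) (proj₂ e)) es
    within = All.map (proj₂ ∘ proj₂) wellFormed

  size : ℕ → Region → Carrier
  size n T = count T 0 n #1

  Sparse : ℕ → List Edge → Set
  Sparse n es = ∀ T → load T es ≼ size n T

  -- This is one half of predimension 0; `Sparse` supplies the other.
  Tight : ℕ → List Edge → Region → Set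
  Tight n es T = size n T ≼ load T es

  load-cong : ∀ {n es T T′} → All (λ e → All (ℕ._< n) (proj₂ e)) es → T ≗[ n ] T′ → load T es ≡ load T′ es
  load-cong []         eq = refl
  load-cong (X< ∷ es<) eq = cong₂ _⊕_ (cong (λ b → ind b (α _)) (covers-cong X< eq)) (load-cong es< eq)

  size-cong : ∀ {n T T′} → T ≗[ n ] T′ → size n T ≡ size n T′
  size-cong {n} eq = cong _#1 (count-cong 0 n eq)

  load-++ : ∀ T es fs → load T (es ++ fs) ≈ load T es ⊕ load T fs
  load-++ T []       fs = ≈-sym (⊕-identityˡ (load T fs))
  load-++ T ((E , X) ∷ es) fs = ≈-trans (⊕-congˡ (load-++ T es fs))
    (≈-sym (⊕-assoc (ind (covers T X) (α E)) (load T es) (load T fs)))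

  0≼load : ∀ T es → 0# ≼ load T es
  0≼load T []             = ≼-refl
  0≼load T ((E , X) ∷ es) = ≼-trans (0≼ind (covers T X) (0≼α E)) (x≼x⊕y _ (0≼load T es))

  load-covered : ∀ {T} es → All (λ (E , X) → covers T X ≡ true) es → load T es ≈ weight (List.map proj₁ es)
  load-covered []       []         = ≈-refl
  load-covered (e ∷ es) (eq ∷ eqs) rewrite eq = ⊕-congˡ (load-covered es eqs)

  -- Puts the load of a region into the form that coherence can complete to an integer, the weight
  -- of a list of symbols.
  load-inside : ∀ T es → ∃[ Es ] (weight Es ≈ load T es)
  load-inside T []             = [] , ≈-refl
  load-inside T ((E , X) ∷ es) with load-inside T es | covers T X
  ... | Es , eq | true  = E ∷ Es , ⊕-congˡ eq
  ... | Es , eq | false = Es , ≈-trans eq (≈-sym (⊕-identityˡ _))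

  -- Checked edge by edge: an edge inside both regions lies inside union and intersection, an edge
  -- inside one of them lies inside the union, and an edge that only the union contains helps the
  -- right-hand side.
  load-supermodular : ∀ T T′ es → load T es ⊕ load T′ es ≼ load (T ∪ T′) es ⊕ load (T ∩ T′) es
  load-supermodular T T′ []             = ≼-refl
  load-supermodular T T′ ((E , X) ∷ es) = begin
    (x ⊕ load T es) ⊕ (y ⊕ load T′ es)                 ≈⟨ swap x y _ _ ⟨
    (x ⊕ y) ⊕ (load T es ⊕ load T′ es)                 ≤⟨ ⊕-mono-≼ per-edge (load-supermodular T T′ es) ⟩
    (z ⊕ w) ⊕ (load (T ∪ T′) es ⊕ load (T ∩ T′) es)    ≈⟨ swap z w _ _ ⟩
    (z ⊕ load (T ∪ T′) es) ⊕ (w ⊕ load (T ∩ T′) es)    ∎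
    where
    x = ind (covers T X) (α E)
    y = ind (covers T′ X) (α E)
    z = ind (covers (T ∪ T′) X) (α E)
    w = ind (covers (T ∩ T′) X) (α E)
    swap : ∀ a b c d → (a ⊕ b) ⊕ (c ⊕ d) ≈ (a ⊕ c) ⊕ (b ⊕ d)
    swap = solve 4 (λ a b c d → ((a :+ b) :+ (c :+ d)) ⊜ ((a :+ c) :+ (b :+ d))) ≈-refl
    per-edge : x ⊕ y ≼ z ⊕ w
    per-edge with covers T X in eq | covers T′ X in eq′
    ... | false | false = ⊕-mono-≼ (0≼ind (covers (T ∪ T′) X) (0≼α E)) (0≼ind (covers (T ∩ T′) X) (0≼α E))
    ... | true  | false rewrite covers-∪ˡ T T′ X eq = ⊕-monoʳ-≼ (α E) (0≼ind (covers (T ∩ T′) X) (0≼α E))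
    ... | false | true  rewrite covers-∪ʳ T T′ X eq′ = begin
      0# ⊕ α E ≈⟨ ⊕-comm 0# (α E) ⟩
      α E ⊕ 0# ≤⟨ ⊕-monoʳ-≼ (α E) (0≼ind (covers (T ∩ T′) X) (0≼α E)) ⟩
      α E ⊕ w  ∎
    ... | true  | true  rewrite covers-∪ˡ T T′ X eq | covers-∩ T T′ X eq eq′ = ≼-refl

  size-modular : ∀ n T T′ → size n (T ∪ T′) ⊕ size n (T ∩ T′) ≈ size n T ⊕ size n T′
  size-modular n T T′ = begin-equality
    size n (T ∪ T′) ⊕ size n (T ∩ T′)                   ≈⟨ #1-homo (count (T ∪ T′) 0 n) _ ⟨
    (count (T ∪ T′) 0 n ℕ.+ count (T ∩ T′) 0 n) #1      ≡⟨ cong _#1 (count-∪-∩ T T′ 0 n) ⟩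
    (count T 0 n ℕ.+ count T′ 0 n) #1                   ≈⟨ #1-homo (count T 0 n) _ ⟩
    size n T ⊕ size n T′                                ∎

  -- Joining a tight region does not raise the predimension: by submodularity the predimensions of
  -- `T ∪ T₀` and `T ∩ T₀` add up to at most those of `T` and `T₀`, where `T₀` contributes 0 and
  -- `T ∩ T₀` is nonnegative. All differences are cleared.
  slack-∪ : ∀ {n es T₀} → Sparse n es → Tight n es T₀ → ∀ T {s} →
    s ⊕ load (T ∪ T₀) es ≼ size n (T ∪ T₀) → s ⊕ load T es ≼ size n T
  slack-∪ {n} {es} {T₀} sparse tight T {s} le = ⊕-cancelʳ-≼ (load (T ∪ T₀) es ⊕ load T₀ es) (begin
    (s ⊕ load T es) ⊕ (load (T ∪ T₀) es ⊕ load T₀ es)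
      ≈⟨ solve 4 (λ s l u z → ((s :+ l) :+ (u :+ z)) ⊜ ((s :+ u) :+ (l :+ z))) ≈-refl s (load T es) _ _ ⟩
    (s ⊕ load (T ∪ T₀) es) ⊕ (load T es ⊕ load T₀ es)
      ≤⟨ ⊕-mono-≼ le (load-supermodular T T₀ es) ⟩
    size n (T ∪ T₀) ⊕ (load (T ∪ T₀) es ⊕ load (T ∩ T₀) es)
      ≤⟨ ⊕-monoʳ-≼ _ (⊕-monoʳ-≼ _ (sparse (T ∩ T₀))) ⟩
    size n (T ∪ T₀) ⊕ (load (T ∪ T₀) es ⊕ size n (T ∩ T₀))
      ≈⟨ solve 3 (λ a b c → (a :+ (b :+ c)) ⊜ ((a :+ c) :+ b)) ≈-refl (size n (T ∪ T₀)) _ _ ⟩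
    (size n (T ∪ T₀) ⊕ size n (T ∩ T₀)) ⊕ load (T ∪ T₀) es
      ≈⟨ ⊕-congʳ (size-modular n T T₀) ⟩
    (size n T ⊕ size n T₀) ⊕ load (T ∪ T₀) es
      ≤⟨ ⊕-monoˡ-≼ _ (⊕-monoʳ-≼ _ tight) ⟩
    (size n T ⊕ load T₀ es) ⊕ load (T ∪ T₀) es
      ≈⟨ solve 3 (λ a b c → ((a :+ b) :+ c) ⊜ (a :+ (c :+ b))) ≈-refl (size n T) _ _ ⟩
    size n T ⊕ (load (T ∪ T₀) es ⊕ load T₀ es) ∎)

  _[_≔_] : Region → ℕ → Bool → Region
  (T [ n ≔ b ]) x = if does (x ℕ.≟ n) then b else T x

  reset : ∀ n T b → T n ≡ b → T [ n ≔ b ] ≗[ suc n ] T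
  reset n T b eq x _ with x ℕ.≟ n
  ... | yes refl rewrite dec-true (n ℕ.≟ n) refl = sym eq
  ... | no  x≢n rewrite dec-false (x ℕ.≟ n) x≢n = refl

  -- A finite search, because `f` sees only the part below `n`: both values at the last vertex are
  -- tried, and the recursion minimises over the rest.
  minimiser : ∀ n (f : Region → Carrier) → (∀ T T′ → T ≗[ n ] T′ → f T ≈ f T′) → ∃[ T ] (∀ T′ → f T ≼ f T′)
  minimiser zero    f ext = full , λ T′ → ≼-reflexive (ext full T′ λ _ ())
  minimiser (suc n) f ext with best true | best false
    where
    set-cong : ∀ {T T′} b → T ≗[ n ] T′ → T [ n ≔ b ] ≗[ suc n ] T′ [ n ≔ b ]
    set-cong b eq x x<1+n with x ℕ.≟ n
    ... | yes x≡n rewrite dec-true (x ℕ.≟ n) x≡n = refl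
    ... | no  x≢n rewrite dec-false (x ℕ.≟ n) x≢n = eq x (ℕ.≤∧≢⇒< (ℕ.≤-pred x<1+n) x≢n)
    best : ∀ b → ∃[ T ] (∀ T′ → f (T [ n ≔ b ]) ≼ f (T′ [ n ≔ b ]))
    best b = minimiser n (λ T → f (T [ n ≔ b ])) λ T T′ eq → ext _ _ (set-cong b eq)
  ... | T₁ , least₁ | T₀ , least₀ with ≼-total (f (T₁ [ n ≔ true ])) (f (T₀ [ n ≔ false ]))
  ...   | inj₁ le = T₁ [ n ≔ true ] , λ T′ → below T′ (T′ n) refl
    where
    below : ∀ T′ b → T′ n ≡ b → f (T₁ [ n ≔ true ]) ≼ f T′
    below T′ true  eq = ≼-trans (least₁ T′) (≼-reflexive (ext _ _ (reset n T′ true eq)))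
    below T′ false eq = ≼-trans le (≼-trans (least₀ T′) (≼-reflexive (ext _ _ (reset n T′ false eq))))
  ...   | inj₂ ge = T₀ [ n ≔ false ] , λ T′ → below T′ (T′ n) refl
    where
    below : ∀ T′ b → T′ n ≡ b → f (T₀ [ n ≔ false ]) ≼ f T′
    below T′ false eq = ≼-trans (least₀ T′) (≼-reflexive (ext _ _ (reset n T′ false eq)))
    below T′ true  eq = ≼-trans ge (≼-trans (least₁ T′) (≼-reflexive (ext _ _ (reset n T′ true eq))))

  record Extension (n : ℕ) (es : List Edge) (n′ : ℕ) (es′ : List Edge) : Set where
    field
      n≤n′   : n ℕ.≤ n′
      keeps  : ∀ {e} → e ∈ es → e ∈ es′
      induced : ∀ {e} → e ∈ es′ → All (ℕ._< n) (proj₂ e) → e ∈ es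

  ext-refl : ∀ {n es} → Extension n es n es
  ext-refl = record { n≤n′ = ℕ.≤-refl ; keeps = λ e∈ → e∈ ; induced = λ e∈ _ → e∈ }

  ext-trans : ∀ {n es n′ es′ n″ es″} → Extension n es n′ es′ → Extension n′ es′ n″ es″ → Extension n es n″ es″
  ext-trans p q = record
    { n≤n′ = ℕ.≤-trans P.n≤n′ Q.n≤n′
    ; keeps = Q.keeps ∘ P.keeps
    ; induced = λ e∈ e<n → P.induced (Q.induced e∈ (All.map (λ x<n → ℕ.<-≤-trans x<n P.n≤n′) e<n)) e<n }
    where
    module P = Extension p
    module Q = Extension q

  missing : ℕ → Region → ℕ
  missing n T = count (not ∘ T) 0 n

-- Extending a sparse hypergraph until it is tight

module Closing (em : ExcludedMiddle 0ℓ) (G : OrderedAbelianGroup) (L : Language)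
         (α : Symbol L → OrderedAbelianGroup.Carrier G) (P : Charging.Params em G L α) where
  open OrderedAbelianGroup G
  open OrderedAbelianGroupProperties G
  open Load G L α
  open Charging em G L α using (module Params; module Weights)
  open Params P
  open Weights P
  open Hypergraph em G L α 0≼α
  open ≼-Reasoning

  weight-++ : ∀ Es Fs → weight (Es ++ Fs) ≈ weight Es ⊕ weight Fs
  weight-++ []       Fs = ≈-sym (⊕-identityˡ (weight Fs))
  weight-++ (E ∷ Es) Fs = ≈-trans (⊕-congˡ (weight-++ Es Fs)) (≈-sym (⊕-assoc (α E) (weight Es) (weight Fs)))

  -- Coherence freed of rationals: an edge of any symbol can be completed by further edges to the
  -- same integral weight.
  record Coherence : Set where
    field
      unit       : ℕ
      1≤unit     : 1 ℕ.≤ unit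
      symbol     : Symbol L
      complement : ∀ E → ∃[ Es ] (α E ⊕ weight Es ≈ unit #1)

  module _ (coherence : Coherence) where
    open Coherence coherence

    multiple : ∀ k → ∃[ Es ] (weight Es ≈ (k ℕ.* unit) #1)
    multiple zero    = [] , ≈-refl
    multiple (suc k) with complement symbol | multiple k
    ... | Es , eq | Fs , eq′ = symbol ∷ Es ++ Fs , (begin-equality
      α symbol ⊕ weight (Es ++ Fs)         ≈⟨ ⊕-congˡ (weight-++ Es Fs) ⟩
      α symbol ⊕ (weight Es ⊕ weight Fs)   ≈⟨ ⊕-assoc (α symbol) (weight Es) (weight Fs) ⟨
      α symbol ⊕ weight Es ⊕ weight Fs     ≈⟨ ⊕-cong eq eq′ ⟩
      unit #1 ⊕ (k ℕ.* unit) #1            ≈⟨ #1-homo unit (k ℕ.* unit) ⟨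
      (unit ℕ.+ k ℕ.* unit) #1             ∎)

    -- Every member of `Es` brings its own complement; the units added in the base case push the
    -- total beyond `k`.
    complete : ∀ Es k → ∃[ Fs ] ∃[ m ] (weight Fs ⊕ weight Es ≈ m #1 × k ℕ.≤ m)
    complete [] k with multiple k
    ... | Fs , eq = Fs , k ℕ.* unit , ≈-trans (⊕-identityʳ (weight Fs)) eq ,
      subst (ℕ._≤ k ℕ.* unit) (ℕ.*-identityʳ k) (ℕ.*-monoʳ-≤ k 1≤unit)
    complete (E ∷ Es) k with complement E | complete Es k
    ... | Hs , eq | Fs , m , eq′ , k≤m = Hs ++ Fs , unit ℕ.+ m , (begin-equality
      weight (Hs ++ Fs) ⊕ (α E ⊕ weight Es)          ≈⟨ ⊕-congʳ (weight-++ Hs Fs) ⟩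
      (weight Hs ⊕ weight Fs) ⊕ (α E ⊕ weight Es)
        ≈⟨ solve 4 (λ h f a e → ((h :+ f) :+ (a :+ e)) ⊜ ((a :+ h) :+ (f :+ e))) ≈-refl (weight Hs) (weight Fs) (α E) (weight Es) ⟩
      (α E ⊕ weight Hs) ⊕ (weight Fs ⊕ weight Es)    ≈⟨ ⊕-cong eq eq′ ⟩
      unit #1 ⊕ m #1                                 ≈⟨ #1-homo unit m ⟨
      (unit ℕ.+ m) #1                                ∎)
      , ℕ.m≤n⇒m≤o+n unit k≤m

    maxArity : ∃[ b ] (∀ E → arity L E ℕ.≤ b)
    maxArity = bounded (arity L)

    maxWidth : ℕ
    maxWidth = (proj₁ maxArity ∸ 2) ℕ.+ (2 ℕ.+ K)

    record Cover (n : ℕ) (es : List Edge) (T₀ : Region) : Set where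
      field
        n′        : ℕ
        es′       : List Edge
        T₀′       : Region
        valid     : Valid n′ es′
        sparse    : Sparse n′ es′
        tight     : Tight n′ es′ T₀′
        extension : Extension n es n′ es′
        progress  : missing n′ T₀′ ℕ.< missing n T₀

    record Root (n : ℕ) (es : List Edge) (T₀ : Region) (a : ℕ) : Set where
      field
        S      : Region
        s      : Carrier
        a∈S    : S a ≡ true
        T₀⊆S   : ∀ x → T₀ x ≡ true → S x ≡ true
        slack  : s ⊕ load S es ≈ size n S
        0≼s    : 0# ≼ s
        s≼1    : s ≼ 1#
        rooted : ∀ T → T a ≡ true → s ⊕ load T es ≼ size n T

    -- The minimum is taken over the regions that contain `T₀` as well as `a`, so that the next
    -- tight region will contain the present one. By `slack-∪` it is still a lower bound for all
    -- regions containing `a`; comparison with the singleton of `a` gives `s ≼ 1#`.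
    root : ∀ {n es T₀} a → Valid n es → Sparse n es → Tight n es T₀ → Root n es T₀ a
    root {n} {es} {T₀} a valid sparse tight = choose (minimiser n f λ T T′ eq →
        reflexive (slack-cong λ x x<n → cong (λ b → (b ∨ ⁅ a ⁆ x) ∨ T₀ x) (eq x x<n)))
      where
      module V = Valid valid
      slack : Region → Carrier
      slack T = size n T ⊕ ⊖ load T es
      -- Joining `a` and `T₀` to the argument turns the constrained minimum into one over all
      -- regions.
      f : Region → Carrier
      f T = slack ((T ∪ ⁅ a ⁆) ∪ T₀)
      slack-cong : ∀ {T T′} → T ≗[ n ] T′ → slack T ≡ slack T′
      slack-cong eq = cong₂ (λ x y → x ⊕ ⊖ y) (size-cong eq) (load-cong V.within eq)
      slack⊕load : ∀ T → slack T ⊕ load T es ≈ size n T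
      slack⊕load T = ≈-trans (⊕-comm (slack T) (load T es)) (x⊕[y⊖x]≈y (load T es) (size n T))
      0≼slack : ∀ T → 0# ≼ slack T
      0≼slack T = ⊕-cancelʳ-≼ (load T es) (begin
        0# ⊕ load T es       ≈⟨ ⊕-identityˡ (load T es) ⟩
        load T es            ≤⟨ sparse T ⟩
        size n T             ≈⟨ slack⊕load T ⟨
        slack T ⊕ load T es  ∎)
      absorb : ∀ T → T a ≡ true → ∀ x → (T ∪ ⁅ a ⁆) x ≡ T x
      absorb T a∈T x with x ℕ.≟ a
      ... | yes refl rewrite a∈T = refl
      ... | no x≢a rewrite dec-false (x ℕ.≟ a) x≢a = Bool.∨-identityʳ (T x)
      choose : ∃[ T ] (∀ T′ → f T ≼ f T′) → Root n es T₀ a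
      choose (T₁ , least) = record
        { S = S ; s = slack S
        ; a∈S = cong (_∨ T₀ a) (trans (cong (T₁ a ∨_) (dec-true (a ℕ.≟ a) refl)) (Bool.∨-zeroʳ _))
        ; T₀⊆S = λ x x∈ → trans (cong ((T₁ ∪ ⁅ a ⁆) x ∨_) x∈) (Bool.∨-zeroʳ _)
        ; slack = slack⊕load S
        ; 0≼s = 0≼slack S
        ; s≼1 = begin
            slack S                   ≤⟨ x≼x⊕y (slack S) (0≼load ⁅ a ⁆ es) ⟩
            slack S ⊕ load ⁅ a ⁆ es   ≤⟨ rooted ⁅ a ⁆ (dec-true (a ℕ.≟ a) refl) ⟩
            size n ⁅ a ⁆              ≤⟨ #1-mono (count-⁅⁆ a 0 n) ⟩
            1# ⊕ 0#                   ≈⟨ ⊕-identityʳ 1# ⟩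
            1#                        ∎
        ; rooted = rooted }
        where
        S : Region
        S = (T₁ ∪ ⁅ a ⁆) ∪ T₀
        rooted : ∀ T → T a ≡ true → slack S ⊕ load T es ≼ size n T
        rooted T a∈T = slack-∪ {n} {es} {T₀} sparse tight T (begin
          slack S ⊕ load (T ∪ T₀) es          ≤⟨ ⊕-monoˡ-≼ _ (least T) ⟩
          f T ⊕ load (T ∪ T₀) es              ≡⟨ cong (_⊕ load (T ∪ T₀) es) (slack-cong λ x _ → cong (_∨ T₀ x) (absorb T a∈T x)) ⟩
          slack (T ∪ T₀) ⊕ load (T ∪ T₀) es   ≈⟨ slack⊕load (T ∪ T₀) ⟩
          size n (T ∪ T₀)                     ∎)

    -- The symbols that complete the edges inside `S` to weight m weigh m minus the load of `S`,
    -- which is s plus m minus the size of `S`. Asking `complete` for that size plus twice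
    -- `maxWidth` makes the integer part long enough for the cycle.
    supply : ∀ n es S s → s ⊕ load S es ≈ size n S →
      ∃[ Es ] ∃[ p ] (weight Es ≈ s ⊕ p #1 × maxWidth ℕ.+ maxWidth ℕ.≤ p)
    supply n es S s slack with load-inside S es
    ... | Fs , Fs≈ with complete Fs (count S 0 n ℕ.+ (maxWidth ℕ.+ maxWidth))
    ...   | Es , m , eq , large = Es , m ℕ.∸ c
          , ⊕-cancelˡ-≈ (load S es) (begin-equality
              load S es ⊕ weight Es               ≈⟨ ⊕-comm (load S es) (weight Es) ⟩
              weight Es ⊕ load S es               ≈⟨ ⊕-congˡ Fs≈ ⟨
              weight Es ⊕ weight Fs               ≈⟨ eq ⟩
              m #1                                ≡⟨ cong _#1 (ℕ.m+[n∸m]≡n (ℕ.m+n≤o⇒m≤o c large)) ⟨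
              (c ℕ.+ (m ℕ.∸ c)) #1                ≈⟨ #1-homo c (m ℕ.∸ c) ⟩
              size n S ⊕ (m ℕ.∸ c) #1             ≈⟨ ⊕-congʳ slack ⟨
              s ⊕ load S es ⊕ (m ℕ.∸ c) #1
                ≈⟨ solve 3 (λ s l p → ((s :+ l) :+ p) ⊜ (l :+ (s :+ p))) ≈-refl s (load S es) ((m ℕ.∸ c) #1) ⟩
              load S es ⊕ (s ⊕ (m ℕ.∸ c) #1)      ∎)
          , ℕ.m+n≤o⇒m≤o∸n (maxWidth ℕ.+ maxWidth) (subst (ℕ._≤ m) (ℕ.+-comm c (maxWidth ℕ.+ maxWidth)) large)
      where
      c = count S 0 n

    module Attach {n : ℕ} {es : List Edge} {T₀ : Region} {a : ℕ} (valid : Valid n es) (sparse : Sparse n es)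
      (a<n : a ℕ.< n) (a∉T₀ : T₀ a ≡ false) (R : Root n es T₀ a) (p : ℕ)
      (long : ∀ E → Blocks.width n a p K a<n (arity L E) ℕ.+ Blocks.width n a p K a<n (arity L E) ℕ.< suc p)
      (Es : List (Symbol L)) (weight-Es : weight Es ≈ Root.s R ⊕ p #1)
      (placement : Cycle.Placement n a p a<n long 0 K (Root.s R) p Es) where
      open Root R
      open Blocks n a p K a<n
      open Cycle n a p a<n long
      module V = Valid valid
      module Pl = Placement placement

      n′ : ℕ
      n′ = n ℕ.+ p

      new es′ : List Edge
      new = List.map edge Pl.keys
      es′ = new ++ es

      InRange : Key → Set
      InRange (_ , i , j) = i ℕ.< suc p × j ℕ.≤ K
      new-wellFormed : ∀ {k} → InRange k →
        length (proj₂ (edge k)) ≡ arity L (proj₁ k) × Unique (proj₂ (edge k)) × All (ℕ._< n′) (proj₂ (edge k))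
      new-wellFormed {E , i , j} (_ , j≤K) = block-length i j (2≤arity L E)
        , block-unique (arity L E) (long E) i j≤K , block-bound (arity L E) (long E) i j
      old-wellFormed : ∀ {e : Edge} → length (proj₂ e) ≡ arity L (proj₁ e) × Unique (proj₂ e) × All (ℕ._< n) (proj₂ e) →
        length (proj₂ e) ≡ arity L (proj₁ e) × Unique (proj₂ e) × All (ℕ._< n′) (proj₂ e)
      old-wellFormed (l , u , b) = l , u , All.map (ℕ.m≤n⇒m≤n+o p) b
      new-apart : ∀ {k k′} → InRange k → InRange k′ → proj₂ k ≢ proj₂ k′ →
        proj₁ (edge k) ≡ proj₁ (edge k′) → ¬ proj₂ (edge k) ≋ proj₂ (edge k′)
      new-apart {E , i , j} (i< , j≤) (i′< , j′≤) k≢k′ refl X≋ =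
        k≢k′ (block-injective (arity L E) (long E) i< i′< j≤ j′≤ X≋)
      -- Every new edge has a new vertex. This keeps the old hypergraph induced and the new edges
      -- different from the old ones.
      new-beyond : ∀ {k} → InRange k → ¬ All (ℕ._< n) (proj₂ (edge k))
      new-beyond {E , i , j} (_ , j≤K) X< with block-new (arity L E) (long E) i j≤K
      ... | x , x∈ , n≤x = ℕ.<⇒≱ (All.lookup X< x∈) n≤x

      new-old-apart : ∀ {k X} → InRange k → All (ℕ._< n) X → ¬ proj₂ (edge k) ≋ X
      new-old-apart {k} r X< (sub , _) = new-beyond {k} r (All.anti-mono sub X<)

      induced : ∀ {e} → e ∈ es′ → All (ℕ._< n) (proj₂ e) → e ∈ es
      induced e∈ e<n with ∈.∈-++⁻ new e∈
      ... | inj₂ e∈es  = e∈es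
      ... | inj₁ e∈new with ∈.∈-map⁻ edge e∈new
      ...   | k , k∈ , refl = contradiction e<n (new-beyond (All.lookup Pl.inRange k∈))

      size-n′ : ∀ T → size n′ T ≈ size n T ⊕ count T n p #1
      size-n′ T = ≈-trans (reflexive (cong _#1 (count-+ T 0 n p))) (#1-homo (count T 0 n) (count T n p))

      -- New edges inside `T` are paid by the new vertices of `T` and, only if `a` is in `T`, by a
      -- further `s`. In that case `rooted` says that the old part of `T` has this much to spare.
      sparse′ : Sparse n′ es′
      sparse′ T = begin
        load T es′                                        ≈⟨ load-++ T new es ⟩
        load T new ⊕ load T es                            ≤⟨ ⊕-monoˡ-≼ (load T es) (Pl.bound T) ⟩
        (ind (T a) s ⊕ count T n p #1) ⊕ load T es
          ≈⟨ solve 3 (λ x y z → ((x :+ y) :+ z) ⊜ ((x :+ z) :+ y)) ≈-refl (ind (T a) s) _ _ ⟩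
        (ind (T a) s ⊕ load T es) ⊕ count T n p #1        ≤⟨ ⊕-monoˡ-≼ _ (at-root (T a) refl) ⟩
        size n T ⊕ count T n p #1                         ≈⟨ size-n′ T ⟨
        size n′ T                                         ∎
        where
        at-root : ∀ b → T a ≡ b → ind b s ⊕ load T es ≼ size n T
        at-root true  a∈T = rooted T a∈T
        at-root false _   = ≼-trans (≼-reflexive (⊕-identityˡ (load T es))) (sparse T)

      S′ : Region
      S′ = S ∪ λ x → does (n ℕ.≤? x)
      S′-new : ∀ x → n ℕ.≤ x → S′ x ≡ true
      S′-new x n≤x = trans (cong (S x ∨_) (dec-true (n ℕ.≤? x) n≤x)) (Bool.∨-zeroʳ (S x))
      S′-old : S′ ≗[ n ] S
      S′-old x x<n = trans (cong (S x ∨_) (dec-false (n ℕ.≤? x) (ℕ.<⇒≱ x<n))) (Bool.∨-identityʳ (S x))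
      S′-vertex : ∀ i → S′ (vertex i) ≡ true
      S′-vertex zero    = cong (_∨ does (n ℕ.≤? a)) a∈S
      S′-vertex (suc i) = S′-new (i ℕ.+ n) (ℕ.m≤n+m n i)
      S′-covers : ∀ r i j → covers S′ (block r i j) ≡ true
      S′-covers r i j = covers⁺ S′ (block r i j) λ x∈ → on-cycle (∈.∈-map⁻ _ x∈)
        where
        on-cycle : ∀ {x} → ∃[ d ] (d ∈ offsets r j × x ≡ vertex ((i ℕ.+ d) ℕ.% suc p)) → S′ x ≡ true
        on-cycle (d , _ , refl) = S′-vertex ((i ℕ.+ d) ℕ.% suc p)

      -- All new edges lie inside `S′`, because the cycle has no old vertex except `a`. Their weight
      -- `s ⊕ p #1` uses up the slack of `S` and one unit for each of the `p` new vertices.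
      tight′ : Tight n′ es′ S′
      tight′ = begin
        size n′ S′                          ≈⟨ size-n′ S′ ⟩
        size n S′ ⊕ count S′ n p #1         ≡⟨ cong₂ (λ x k → x ⊕ k #1) (size-cong S′-old) (count-all n p S′-new) ⟩
        size n S ⊕ p #1                     ≈⟨ ⊕-congʳ slack ⟨
        s ⊕ load S es ⊕ p #1
          ≈⟨ solve 3 (λ s l p → ((s :+ l) :+ p) ⊜ ((s :+ p) :+ l)) ≈-refl s (load S es) (p #1) ⟩
        s ⊕ p #1 ⊕ load S es                ≈⟨ ⊕-congʳ weight-Es ⟨
        weight Es ⊕ load S es               ≡⟨ cong₂ (λ Fs x → weight Fs ⊕ x)
                                                 (trans (sym Pl.labels) (List.map-∘ Pl.keys))
                                                 (sym (load-cong V.within S′-old)) ⟩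
        weight (List.map proj₁ new) ⊕ load S′ es
          ≈⟨ ⊕-congʳ (load-covered new (All.map⁺ (All.tabulate λ {(E , i , j)} _ → S′-covers (arity L E) i j))) ⟨
        load S′ new ⊕ load S′ es            ≈⟨ load-++ S′ new es ⟨
        load S′ es′                         ∎

      -- The new vertices all belong to `S′`, so only old ones can be missing, and `a` no longer is.
      progress : missing n′ S′ ℕ.< missing n T₀
      progress = subst (ℕ._< missing n T₀) (sym missing≡)
        (count-strict 0 n (λ x → not-anti (T₀ x) (S x) (T₀⊆S x))
          (cong not a∈S) (cong not a∉T₀) z≤n a<n)
        where
        not-anti : ∀ b c → (b ≡ true → c ≡ true) → not c ≡ true → not b ≡ true
        not-anti false c     imp _  = refl
        not-anti true  false imp _  = contradiction (imp refl) λ ()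
        not-anti true  true  imp eq = eq
        missing≡ : missing n′ S′ ≡ missing n S
        missing≡ = trans (count-+ (not ∘ S′) 0 n p) (trans
          (cong₂ ℕ._+_ (count-cong 0 n λ x x<n → cong not (S′-old x x<n))
                       (count-none n p λ x n≤x → cong not (S′-new x n≤x)))
          (ℕ.+-identityʳ (missing n S)))

      valid′ : Valid n′ es′
      valid′ = record
        { wellFormed = All.++⁺ (All.map⁺ (All.map new-wellFormed Pl.inRange)) (All.map old-wellFormed V.wellFormed)
        ; apart      = AllPairs.++⁺
            (AllPairs.map⁺ (AllPairs-map-All new-apart Pl.inRange Pl.distinct)) V.apart
            (All.map⁺ (All.map (λ {k} r → All.map (λ {e} X< _ → new-old-apart {k} r X<) V.within) Pl.inRange))
        }

      result : Cover n es T₀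
      result = record
        { n′ = n′ ; es′ = es′ ; T₀′ = S′ ; valid = valid′ ; sparse = sparse′ ; tight = tight′
        ; extension = record
          { n≤n′ = ℕ.m≤m+n n p
          ; keeps = ∈.∈-++⁺ʳ new
          ; induced = induced }
        ; progress = progress
        }

    cover : ∀ {n es T₀ a} → Valid n es → Sparse n es → Tight n es T₀ → a ℕ.< n → T₀ a ≡ false → Cover n es T₀
    cover {n} {es} {T₀} {a} valid sparse tight a<n a∉T₀ =
      attach (supply n es S s slack)
      where
      R : Root n es T₀ a
      R = root a valid sparse tight
      open Root R
      attach : ∃[ Es ] ∃[ p ] (weight Es ≈ s ⊕ p #1 × maxWidth ℕ.+ maxWidth ℕ.≤ p) → Cover n es T₀
      attach (Es , p , weight-Es , large) = Attach.result valid sparse a<n a∉T₀ R p long Es weight-Es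
        (Cycle.distribute n a p a<n long Es 0 K s p refl ℕ.≤-refl 0≼s (≼-trans s≼1 1≼Kε) weight-Es)
        where
        open Blocks n a p K a<n
        width≤ : ∀ E → width (arity L E) ℕ.≤ maxWidth
        width≤ E = ℕ.+-monoˡ-≤ (2 ℕ.+ K) (ℕ.∸-monoˡ-≤ 2 (proj₂ maxArity E))
        long : ∀ E → width (arity L E) ℕ.+ width (arity L E) ℕ.< suc p
        long E = s≤s (ℕ.≤-trans (ℕ.+-mono-≤ (width≤ E) (width≤ E)) large)

    record Closure (n : ℕ) (es : List Edge) : Set where
      field
        n′        : ℕ
        es′       : List Edge
        valid     : Valid n′ es′
        sparse    : Sparse n′ es′
        tight     : n′ #1 ≼ load full es′
        extension : Extension n es n′ es′

    -- The number of vertices may grow at every step; what decreases is the number of vertices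
    -- outside the tight region, bounded by `m`.
    close : ∀ m {n es T₀} → missing n T₀ ℕ.≤ m → Valid n es → Sparse n es → Tight n es T₀ → Closure n es
    close m {n} {es} {T₀} missing≤m valid sparse tight with em {∃[ a ] (a ℕ.< n × T₀ a ≡ false)}
    ... | no none = record
      { n′ = n ; es′ = es ; valid = valid ; sparse = sparse ; extension = ext-refl
      ; tight = begin
          n #1           ≡⟨ cong _#1 (count-all 0 n λ _ _ → refl) ⟨
          size n full    ≡⟨ size-cong T₀-full ⟨
          size n T₀      ≤⟨ tight ⟩
          load T₀ es     ≡⟨ load-cong (Valid.within valid) T₀-full ⟩
          load full es   ∎ }
      where
      T₀-full : T₀ ≗[ n ] full
      T₀-full x x<n = Bool.¬-not λ x∉ → none (x , x<n , x∉)
    close zero missing≤0 valid sparse tight | yes (a , a<n , a∉T₀) =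
      contradiction (ℕ.<-≤-trans (Cover.progress (cover valid sparse tight a<n a∉T₀)) missing≤0) ℕ.n≮0
    close (suc m) missing≤1+m valid sparse tight | yes (a , a<n , a∉T₀) = record
      { Closure rest ; extension = ext-trans C.extension (Closure.extension rest) }
      where
      module C = Cover (cover valid sparse tight a<n a∉T₀)
      rest = close m (ℕ.≤-pred (ℕ.≤-trans C.progress missing≤1+m)) C.valid C.sparse C.tight

    closure : ∀ {n es} → Valid n es → Sparse n es → Closure n es
    -- The process starts from the empty region, which is tight because its size is 0.
    closure {n} {es} valid sparse = close (missing n (λ _ → false)) ℕ.≤-refl valid sparse
      (≼-trans (≼-reflexive (reflexive (cong _#1 (count-none 0 n λ _ _ → refl)))) (0≼load (λ _ → false) es))

-- Lists and tuples compared as sets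

≋-refl : ∀ {A : Set} {xs : List A} → xs ≋ xs
≋-refl = (λ x∈ → x∈) , (λ x∈ → x∈)

≋-sym : ∀ {A : Set} {xs ys : List A} → xs ≋ ys → ys ≋ xs
≋-sym (p , q) = q , p

≋-trans : ∀ {A : Set} {xs ys zs : List A} → xs ≋ ys → ys ≋ zs → xs ≋ zs
≋-trans (p , q) (p′ , q′) = p′ ∘ p , q ∘ q′

map-⊆ : ∀ {A B : Set} (f : A → B) {xs ys} → xs ⊆ ys → List.map f xs ⊆ List.map f ys
map-⊆ f sub fx∈ with ∈.∈-map⁻ f fx∈
... | x , x∈ , refl = ∈.∈-map⁺ f (sub x∈)

map-≋ : ∀ {A B : Set} (f : A → B) {xs ys} → xs ≋ ys → List.map f xs ≋ List.map f ys
map-≋ f (p , q) = map-⊆ f p , map-⊆ f q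

map-⊆⁻ : ∀ {A B : Set} (f : A → B) → (∀ {x y} → f x ≡ f y → x ≡ y) → ∀ {xs ys} →
  List.map f xs ⊆ List.map f ys → xs ⊆ ys
map-⊆⁻ f inj sub x∈ with ∈.∈-map⁻ f (sub (∈.∈-map⁺ f x∈))
... | y , y∈ , eq = subst (_∈ _) (sym (inj eq)) y∈

map-≋⁻ : ∀ {A B : Set} (f : A → B) → (∀ {x y} → f x ≡ f y → x ≡ y) → ∀ {xs ys} →
  List.map f xs ≋ List.map f ys → xs ≋ ys
map-≋⁻ f inj (p , q) = map-⊆⁻ f inj p , map-⊆⁻ f inj q

↭⇒≋ : ∀ {A : Set} {xs ys : List A} → xs ↭ ys → xs ≋ ys
↭⇒≋ p = ↭.∈-resp-↭ p , ↭.∈-resp-↭ (↭-sym p)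

unique-resp-↭ : ∀ {A : Set} {xs ys : List A} → xs ↭ ys → Unique xs → Unique ys
unique-resp-↭ {A} p = Permutationₛ.Unique-resp-↭ (setoid A) (↭⇒↭ₛ p)

∈-remove : ∀ {A : Set} {x y : A} us {vs} → x ∈ us ++ y ∷ vs → x ≢ y → x ∈ us ++ vs
∈-remove us x∈ x≢y with ∈.∈-++⁻ us x∈
... | inj₁ x∈us         = ∈.∈-++⁺ˡ x∈us
... | inj₂ (here x≡y)   = contradiction x≡y x≢y
... | inj₂ (there x∈vs) = ∈.∈-++⁺ʳ us x∈vs

unique-≋⇒↭ : ∀ {A : Set} {xs ys : List A} → Unique xs → Unique ys → xs ≋ ys → xs ↭ ys
unique-≋⇒↭ {xs = []} {[]} _ _ _ = ↭-refl
unique-≋⇒↭ {xs = []} {y ∷ ys} _ _ (_ , sup) with sup (here refl)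
... | ()
unique-≋⇒↭ {xs = x ∷ xs} {ys} (x∉xs ∷ xs!) ys! (sub , sup) with ∈.∈-∃++ (sub (here refl))
... | us , vs , refl with unique-resp-↭ (↭.shift x us vs) ys!
...   | x∉ ∷ uvs! = ↭-trans (prep x (unique-≋⇒↭ xs! uvs! (sub′ , sup′))) (↭-sym (↭.shift x us vs))
  where
  sub′ : xs ⊆ us ++ vs
  sub′ z∈ = ∈-remove us (sub (there z∈)) λ z≡x → All.lookup x∉xs z∈ (sym z≡x)
  sup′ : us ++ vs ⊆ xs
  sup′ z∈ with sup (↭.∈-resp-↭ (↭-sym (↭.shift x us vs)) (there z∈))
  ... | here z≡x = contradiction (sym z≡x) (All.lookup x∉ z∈)
  ... | there z∈xs = z∈xs

-- Stated for a relation rather than a function, since the same set appears as a list of naturals,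
-- as a tuple and as a `Subset`, and these are matched only up to enumeration.
pigeonhole : ∀ {A B : Set} (R : A → B → Set) {xs ys} →
  AllPairs (λ x x′ → ∀ y → R x y → ¬ R x′ y) xs →
  (∀ {x} → x ∈ xs → ∃[ y ] (y ∈ ys × R x y)) → length xs ℕ.≤ length ys
pigeonhole R []               image = z≤n
pigeonhole R {x ∷ xs} (x# ∷ xs#) image with image (here refl)
... | y , y∈ , Rxy with ∈.∈-∃++ y∈
...   | us , vs , refl = subst (suc (length xs) ℕ.≤_) (sym (↭.↭-length (↭.shift y us vs)))
  (s≤s (pigeonhole R xs# image′))
  where
  image′ : ∀ {x′} → x′ ∈ xs → ∃[ y′ ] (y′ ∈ us ++ vs × R x′ y′)
  image′ x′∈ with image (there x′∈)
  ... | y′ , y′∈ , Rx′y′ = y′ , ∈-remove us y′∈ (λ { refl → All.lookup x# x′∈ y Rxy Rx′y′ }) , Rx′y′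

lookup-injective : ∀ {A : Set} {xs : List A} → Unique xs → ∀ i j → List.lookup xs i ≡ List.lookup xs j → i ≡ j
lookup-injective (x∉ ∷ xs!) Fin.zero    Fin.zero    eq = refl
lookup-injective (x∉ ∷ xs!) Fin.zero    (Fin.suc j) eq = contradiction eq (All.lookup x∉ (∈.∈-lookup j))
lookup-injective (x∉ ∷ xs!) (Fin.suc i) Fin.zero    eq = contradiction (sym eq) (All.lookup x∉ (∈.∈-lookup i))
lookup-injective (x∉ ∷ xs!) (Fin.suc i) (Fin.suc j) eq = cong Fin.suc (lookup-injective xs! i j eq)

toList-unique⁺ : ∀ {A : Set} {n} {as : Vec A n} → VecUnique as → Unique (toList as)
toList-unique⁺ VecAllPairs.[]         = []
toList-unique⁺ (a∉ VecAllPairs.∷ as!) = VecAll.toList⁺ a∉ ∷ toList-unique⁺ as!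

toList-unique⁻ : ∀ {A : Set} {n} {as : Vec A n} → Unique (toList as) → VecUnique as
toList-unique⁻ {as = []}     []         = VecAllPairs.[]
toList-unique⁻ {as = a ∷ as} (a∉ ∷ as!) = VecAll.toList⁻ a∉ VecAllPairs.∷ toList-unique⁻ as!

Vec-preimage : ∀ {A B : Set} (f : A → B) {n} (bs : Vec B n) →
  (∀ {b} → b ∈ toList bs → ∃[ a ] (f a ≡ b)) → ∃[ as ] (Vec.map f as ≡ bs)
Vec-preimage f []       pre = [] , refl
Vec-preimage f (b ∷ bs) pre with pre (here refl) | Vec-preimage f bs (pre ∘ there)
... | a , refl | as , refl = a ∷ as , refl

range : Region → ℕ → ℕ → List ℕ
range T k zero    = []
range T k (suc u) = if T k then k ∷ range T (suc k) u else range T (suc k) u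

length-range : ∀ T k u → length (range T k u) ≡ count T k u
length-range T k zero    = refl
length-range T k (suc u) with T k
... | true  = cong suc (length-range T (suc k) u)
... | false = length-range T (suc k) u

∈-range⁻ : ∀ T k u {x} → x ∈ range T k u → (k ℕ.≤ x × x ℕ.< k ℕ.+ u) × T x ≡ true
∈-range⁻ T k (suc u) {x} x∈ = peel (T k) refl x∈
  where
  later : x ∈ range T (suc k) u → (k ℕ.≤ x × x ℕ.< k ℕ.+ suc u) × T x ≡ true
  later x∈ with ∈-range⁻ T (suc k) u x∈
  ... | (k<x , x<) , Tx = (ℕ.<⇒≤ k<x , subst (x ℕ.<_) (sym (ℕ.+-suc k u)) x<) , Tx
  peel : ∀ b → T k ≡ b → x ∈ (if b then k ∷ range T (suc k) u else range T (suc k) u) →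
    (k ℕ.≤ x × x ℕ.< k ℕ.+ suc u) × T x ≡ true
  peel true  eq (here refl) = (ℕ.≤-refl , ℕ.m<m+n k (s≤s z≤n)) , eq
  peel true  eq (there x∈)  = later x∈
  peel false eq x∈          = later x∈

∈-range⁺ : ∀ T k u {x} → k ℕ.≤ x → x ℕ.< k ℕ.+ u → T x ≡ true → x ∈ range T k u
∈-range⁺ T k zero    {x} k≤x x< Tx = contradiction (subst (x ℕ.<_) (ℕ.+-identityʳ k) x<) (ℕ.≤⇒≯ k≤x)
∈-range⁺ T k (suc u) {x} k≤x x< Tx with ℕ.m≤n⇒m<n∨m≡n k≤x
... | inj₂ refl rewrite Tx = here refl
... | inj₁ k<x with T k | ∈-range⁺ T (suc k) u k<x (subst (x ℕ.<_) (ℕ.+-suc k u) x<) Tx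
...   | true  | x∈ = there x∈
...   | false | x∈ = x∈

range-unique : ∀ T k u → Unique (range T k u)
range-unique T k zero    = []
range-unique T k (suc u) with T k
... | true  = All.tabulate (λ x∈ → ℕ.<⇒≢ (proj₁ (proj₁ (∈-range⁻ T (suc k) u x∈)))) ∷ range-unique T (suc k) u
... | false = range-unique T (suc k) u

∈-underlyingSet⁺ : ∀ {n r} (as : Vec (Fin n) r) {x} → x ∈ toList as → x Subset.∈ underlyingSet as
∈-underlyingSet⁺ (a ∷ as) (here refl) = Subset.x∈p∪q⁺ (inj₁ (Subset.x∈⁅x⁆ a))
∈-underlyingSet⁺ (a ∷ as) (there x∈)  = Subset.x∈p∪q⁺ (inj₂ (∈-underlyingSet⁺ as x∈))

∈-underlyingSet⁻ : ∀ {n r} (as : Vec (Fin n) r) {x} → x Subset.∈ underlyingSet as → x ∈ toList as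
∈-underlyingSet⁻ []       x∈ = ⊥-elim (Subset.∉⊥ x∈)
∈-underlyingSet⁻ (a ∷ as) x∈ with Subset.x∈p∪q⁻ Subset.⁅ a ⁆ (underlyingSet as) x∈
... | inj₁ x∈a  = here (Subset.x∈⁅y⁆⇒x≡y a x∈a)
... | inj₂ x∈as = there (∈-underlyingSet⁻ as x∈as)

underlyingSet-≡⇒≋ : ∀ {n r} (as bs : Vec (Fin n) r) → underlyingSet as ≡ underlyingSet bs → toList as ≋ toList bs
underlyingSet-≡⇒≋ as bs eq =
  (λ x∈ → ∈-underlyingSet⁻ bs (subst (_ Subset.∈_) eq (∈-underlyingSet⁺ as x∈))) ,
  (λ x∈ → ∈-underlyingSet⁻ as (subst (_ Subset.∈_) (sym eq) (∈-underlyingSet⁺ bs x∈)))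

≋⇒underlyingSet-≡ : ∀ {n r} (as bs : Vec (Fin n) r) → toList as ≋ toList bs → underlyingSet as ≡ underlyingSet bs
≋⇒underlyingSet-≡ as bs (sub , sup) = Subset.⊆-antisym
  (λ x∈ → ∈-underlyingSet⁺ bs (sub (∈-underlyingSet⁻ as x∈)))
  (λ x∈ → ∈-underlyingSet⁺ as (sup (∈-underlyingSet⁻ bs x∈)))

∈-tuples : ∀ {n r} (as : Vec (Fin n) r) → as ∈ tuples n r
∈-tuples []       = here refl
∈-tuples (a ∷ as) = ∈.∈-cartesianProductWith⁺ _∷_ (∈.∈-allFin a) (∈-tuples as)

-- Holding sets and induced substructures

module _ {L : Language} (A : Structure L) (E : Symbol L) where

  relTuples : List (Vec (Fin (card A)) (arity L E))
  relTuples = List.filter (λ as → T? (rel A E as)) (tuples (card A) (arity L E))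

  ∈-relTuples⁺ : ∀ {as} → T (rel A E as) → as ∈ relTuples
  ∈-relTuples⁺ {as} = ∈.∈-filter⁺ (λ as → T? (rel A E as)) (∈-tuples as)

  ∈-relTuples⁻ : ∀ {as} → as ∈ relTuples → T (rel A E as)
  ∈-relTuples⁻ as∈ = proj₂ (∈.∈-filter⁻ (λ as → T? (rel A E as)) {xs = tuples (card A) (arity L E)} as∈)

  ∈-holdingSets⁺ : ∀ {as} → T (rel A E as) → underlyingSet as ∈ holdingSets A E
  ∈-holdingSets⁺ Eas = ∈.∈-deduplicate⁺ _ (∈.∈-map⁺ underlyingSet (∈-relTuples⁺ Eas))

  ∈-holdingSets⁻ : ∀ {X} → X ∈ holdingSets A E → ∃[ as ] (T (rel A E as) × X ≡ underlyingSet as)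
  ∈-holdingSets⁻ X∈ with ∈.∈-map⁻ underlyingSet (∈.∈-deduplicate⁻ _ (List.map underlyingSet relTuples) X∈)
  ... | as , as∈ , eq = as , ∈-relTuples⁻ as∈ , eq

  -- Members of `Xs` are matched with holding sets through a tuple that enumerates both. Two of them
  -- cannot share a holding set, because tuples with one underlying set have images with one
  -- underlying set.
  length≤N : ∀ (f : Fin (card A) → ℕ) {Xs} → AllPairs (λ X Y → ¬ X ≋ Y) Xs →
    (∀ {X} → X ∈ Xs → ∃[ as ] (T (rel A E as) × X ≋ List.map f (toList as))) → length Xs ℕ.≤ N E A
  length≤N f Xs# image = pigeonhole
    (λ X Y → ∃[ as ] (X ≋ List.map f (toList as) × Y ≡ underlyingSet as))
    (AllPairs.map (λ X≉X′ Y (as , X≋ , Y≡) (as′ , X′≋ , Y≡′) →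
      X≉X′ (≋-trans X≋ (≋-trans (map-≋ f (underlyingSet-≡⇒≋ as as′ (trans (sym Y≡) Y≡′))) (≋-sym X′≋)))) Xs#)
    λ X∈ → let as , Eas , X≋ = image X∈ in underlyingSet as , ∈-holdingSets⁺ Eas , as , X≋ , refl

  -- The converse matching; injectivity of `f` prevents two holding sets from having the same image.
  N≤length : ∀ (f : Fin (card A) → ℕ) → (∀ {x y} → f x ≡ f y → x ≡ y) → ∀ {Xs} →
    (∀ as → T (rel A E as) → ∃[ X ] (X ∈ Xs × X ≋ List.map f (toList as))) → N E A ℕ.≤ length Xs
  N≤length f inj image = pigeonhole
    (λ Y X → ∃[ as ] (X ≋ List.map f (toList as) × Y ≡ underlyingSet as))
    (AllPairs.map (λ Y≢Y′ X (as , X≋ , Y≡) (as′ , X≋′ , Y′≡) →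
      Y≢Y′ (trans Y≡ (trans (≋⇒underlyingSet-≡ as as′ (map-≋⁻ f inj (≋-trans (≋-sym X≋) X≋′))) (sym Y′≡))))
      (deduplicate-! _ (List.map underlyingSet relTuples)))
    λ Y∈ → let as , Eas , Y≡ = ∈-holdingSets⁻ Y∈ ; X , X∈ , X≋ = image as Eas in X , X∈ , as , X≋ , Y≡

module _ {L : Language} (A : Structure L) {k} (g : Fin k → Fin (card A)) (g-inj : ∀ {i j} → g i ≡ g j → i ≡ j) where

  pullback : Structure L
  pullback = record
    { card = k
    ; rel = λ E as → rel A E (Vec.map g as)
    ; symmetric = λ E {as} {bs} p → symmetric A E
        (subst₂ _↭_ (sym (Vec.toList-map g as)) (sym (Vec.toList-map g bs)) (↭.map⁺ g p))
    ; irreflexive = λ E {as} Eas → toList-unique⁻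
        (Unique.map⁻ (subst Unique (Vec.toList-map g as) (toList-unique⁺ (irreflexive A E Eas))))
    }

  pullback-↪ : pullback ↪ A
  pullback-↪ = record { to = g ; injective = g-inj ; rel-≡ = λ E as → refl }

-- Translation between structures and hypergraphs

module Translation (em : ExcludedMiddle 0ℓ) (G : OrderedAbelianGroup) (L : Language)
         (α : Symbol L → OrderedAbelianGroup.Carrier G)
         (0≼α : ∀ E → OrderedAbelianGroup._≼_ G (OrderedAbelianGroup.0# G) (α E)) where
  open OrderedAbelianGroup G hiding (setoid)
  open OrderedAbelianGroupProperties G
  open Load G L α
  open Hypergraph em G L α 0≼α
  open ≼-Reasoning

  total : (Symbol L → ℕ) → Carrier
  total c = ∑ (λ E → c E ⋆ α E)

  total-mono : ∀ {c c′} → (∀ E → c E ℕ.≤ c′ E) → total c ≼ total c′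
  total-mono c≤c′ = ∑-mono λ E → ⋆-monoˡ-≼ (0≼α E) (c≤c′ E)
    where
    ∑-mono : ∀ {k} {f g : Fin k → Carrier} → (∀ i → f i ≼ g i) → ∑ f ≼ ∑ g
    ∑-mono {zero}  f≼g = ≼-refl
    ∑-mono {suc k} f≼g = ⊕-mono-≼ (f≼g Fin.zero) (∑-mono (f≼g ∘ Fin.suc))

  ∑-single : ∀ {k} (j : Fin k) x → ∑ (λ i → ind (does (i Fin.≟ j)) x) ≈ x
  ∑-single {suc k} Fin.zero    x = ≈-trans (⊕-congˡ (sum-replicate-zero commutativeMonoid k)) (⊕-identityʳ x)
  ∑-single {suc k} (Fin.suc j) x = ≈-trans (⊕-identityˡ _) (∑-single j x)

  select : Symbol L → Region → List Edge → List (List ℕ)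
  select E R []              = []
  select E R ((E′ , X) ∷ es) = if does (E Fin.≟ E′) ∧ covers R X then X ∷ select E R es else select E R es

  ∈-select⁻ : ∀ E R es {X} → X ∈ select E R es → (E , X) ∈ es × covers R X ≡ true
  ∈-select⁻ E R ((E′ , X) ∷ es) X∈ with E Fin.≟ E′ | covers R X in eq
  ∈-select⁻ E R ((E , X) ∷ es) (here refl) | yes refl | true = here refl , eq
  ∈-select⁻ E R ((E , X) ∷ es) (there X∈) | yes refl | true = let e∈ , c = ∈-select⁻ E R es X∈ in there e∈ , c
  ... | yes refl | false = let e∈ , c = ∈-select⁻ E R es X∈ in there e∈ , c
  ... | no _     | _     = let e∈ , c = ∈-select⁻ E R es X∈ in there e∈ , c

  ∈-select⁺ : ∀ E R es {X} → (E , X) ∈ es → covers R X ≡ true → X ∈ select E R es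
  ∈-select⁺ E R ((E , X) ∷ es) (here refl) c rewrite dec-true (E Fin.≟ E) refl | c = here refl
  ∈-select⁺ E R ((E′ , X) ∷ es) (there X∈) c with does (E Fin.≟ E′) ∧ covers R X
  ... | true  = there (∈-select⁺ E R es X∈ c)
  ... | false = ∈-select⁺ E R es X∈ c

  select-apart : ∀ E R {es} → AllPairs (λ e e′ → proj₁ e ≡ proj₁ e′ → ¬ proj₂ e ≋ proj₂ e′) es →
    AllPairs (λ X Y → ¬ X ≋ Y) (select E R es)
  select-apart E R {[]}            []         = []
  select-apart E R {(E′ , X) ∷ es} (e# ∷ es#) with E Fin.≟ E′ | covers R X
  ... | yes refl | true  = All.tabulate (λ Y∈ → All.lookup e# (proj₁ (∈-select⁻ E R es Y∈)) refl) ∷ select-apart E R es#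
  ... | yes refl | false = select-apart E R es#
  ... | no _     | _     = select-apart E R es#

  -- The load adds edge by edge and the predimension symbol by symbol; sorting the edges by symbol
  -- reconciles the two.
  load≈total : ∀ R es → load R es ≈ total (λ E → length (select E R es))
  load≈total R []              = ≈-sym (sum-replicate-zero commutativeMonoid (#symbols L))
  load≈total R ((E′ , X) ∷ es) = begin-equality
    x ⊕ load R es
      ≈⟨ ⊕-cong (≈-sym (∑-single E′ x)) (load≈total R es) ⟩
    ∑ (λ E → ind (does (E Fin.≟ E′)) x) ⊕ total (λ E → length (select E R es))
      ≈⟨ ∑-distrib-+ commutativeMonoid (λ E → ind (does (E Fin.≟ E′)) x) (λ E → length (select E R es) ⋆ α E) ⟨
    ∑ (λ E → ind (does (E Fin.≟ E′)) x ⊕ length (select E R es) ⋆ α E)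
      ≈⟨ sum-cong-≋ commutativeMonoid per-symbol ⟩
    total (λ E → length (select E R ((E′ , X) ∷ es))) ∎
    where
    x = ind (covers R X) (α E′)
    per-symbol : ∀ E → ind (does (E Fin.≟ E′)) x ⊕ length (select E R es) ⋆ α E
                     ≈ length (select E R ((E′ , X) ∷ es)) ⋆ α E
    per-symbol E with E Fin.≟ E′ | covers R X
    ... | yes refl | true  = ≈-refl
    ... | yes refl | false = ⊕-identityˡ _
    ... | no _     | true  = ⊕-identityˡ _
    ... | no _     | false = ⊕-identityˡ _

  -- Membership in the class of the theorem, with the subtraction cleared.
  Hereditary : Structure L → Set
  Hereditary A = ∀ B → B ↪ A → total (λ E → N E B) ≼ card B #1

  toℕs : ∀ {n r} → Vec (Fin n) r → List ℕ
  toℕs as = List.map toℕ (toList as)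

  toℕs-length : ∀ {n r} (as : Vec (Fin n) r) → length (toℕs as) ≡ r
  toℕs-length as = trans (List.length-map toℕ (toList as)) (Vec.length-toList as)

  toℕs-< : ∀ {n r} (as : Vec (Fin n) r) → All (ℕ._< n) (toℕs as)
  toℕs-< as = All.map⁺ (All.tabulate λ {i} _ → Fin.toℕ<n i)

  fromℕs : ∀ {n} X → All (ℕ._< n) X → ∀ {r} → length X ≡ r → ∃[ as ] (toℕs {n} {r} as ≡ X)
  fromℕs []       []           refl = [] , refl
  fromℕs (x ∷ X) (x<n ∷ X<n) refl with fromℕs X X<n refl
  ... | as , eq = Fin.fromℕ< x<n ∷ as , cong₂ _∷_ (Fin.toℕ-fromℕ< x<n) eq

  SameEdge : Edge → Edge → Set
  SameEdge e e′ = proj₁ e ≡ proj₁ e′ × proj₂ e ≋ proj₂ e′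

  edgeDecSetoid : DecSetoid 0ℓ 0ℓ
  edgeDecSetoid = record
    { Carrier = Edge ; _≈_ = SameEdge
    ; isDecEquivalence = record
      { isEquivalence = record
        { refl = refl , ≋-refl
        ; sym = λ (p , q) → sym p , ≋-sym q
        ; trans = λ (p , q) (p′ , q′) → trans p p′ , ≋-trans q q′ }
      ; _≟_ = λ _ _ → em } }
  open DecSetoid edgeDecSetoid using () renaming (_≟_ to _sameEdge?_)

  module _ (A : Structure L) where

    instances : List Edge
    instances = List.concatMap (λ E → List.map (λ as → E , toℕs as) (relTuples A E)) (allFin (#symbols L))

    -- In `instances` a set occurs once for each of its enumerations; deduplication up to `SameEdge`
    -- leaves one of them.
    edgesOf : List Edge
    edgesOf = List.deduplicate _sameEdge?_ instances

    edgesOf-sound : ∀ {E X} → (E , X) ∈ edgesOf → ∃[ as ] (T (rel A E as) × X ≡ toℕs as)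
    edgesOf-sound e∈ with Any.satisfied (∈.∈-concatMap⁻ _ {xs = allFin (#symbols L)} (∈.∈-deduplicate⁻ _sameEdge?_ instances e∈))
    ... | E′ , e∈map with ∈.∈-map⁻ (λ as → E′ , toℕs as) e∈map
    ...   | as , as∈ , refl = as , ∈-relTuples⁻ A E′ as∈ , refl

    edgesOf-complete : ∀ E as → T (rel A E as) → ∃[ X ] ((E , X) ∈ edgesOf × X ≋ toℕs as)
    edgesOf-complete E as Eas = found (find (Any.deduplicate⁺ _sameEdge?_ {P = SameEdge (E , toℕs as)}
        (λ (p , q) (p′ , q′) → trans p′ (sym p) , ≋-trans q′ (≋-sym q))
        (Any.map (λ { refl → refl , ≋-refl })
          (∈.∈-concatMap⁺ (λ E → List.map (λ as → E , toℕs as) (relTuples A E))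
            (Any.map (λ { refl → ∈.∈-map⁺ (λ as → E , toℕs as) (∈-relTuples⁺ A E Eas) }) (∈.∈-allFin E))))))
      where
      found : ∃[ e ] (e ∈ edgesOf × SameEdge (E , toℕs as) e) → ∃[ X ] ((E , X) ∈ edgesOf × X ≋ toℕs as)
      found ((_ , X) , e∈ , refl , X≋) = X , e∈ , ≋-sym X≋

    edgesOf-valid : Valid (card A) edgesOf
    edgesOf-valid = record
      { wellFormed = All.tabulate λ e∈ → wf (edgesOf-sound e∈)
      ; apart = AllPairs.map (λ ¬same E≡ X≋ → ¬same (E≡ , X≋)) (UniqueDec.deduplicate-! edgeDecSetoid instances) }
      where
      wf : ∀ {E X} → ∃[ as ] (T (rel A E as) × X ≡ toℕs as) → length X ≡ arity L E × Unique X × All (ℕ._< card A) X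
      wf (as , Eas , refl) = toℕs-length as
        , Unique.map⁺ Fin.toℕ-injective (toList-unique⁺ (irreflexive A _ Eas)) , toℕs-< as

    -- The region `R` carries an induced substructure `B`, obtained by listing the elements of `R`
    -- below `card A`. Edges inside `R` are holding sets of `B`, so the condition on `B` is the
    -- required bound.
    edgesOf-sparse : Hereditary A → Sparse (card A) edgesOf
    edgesOf-sparse hereditary R = begin
      load R edgesOf                                  ≈⟨ load≈total R edgesOf ⟩
      total (λ E → length (select E R edgesOf))       ≤⟨ total-mono selected≤N ⟩
      total (λ E → N E B)                             ≤⟨ hereditary B (pullback-↪ A g g-inj) ⟩
      length vs #1                                    ≡⟨ cong _#1 (length-range R 0 (card A)) ⟩
      size (card A) R                                 ∎
      where
      vs = range R 0 (card A)
      v< : ∀ i → List.lookup vs i ℕ.< card A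
      v< i = proj₂ (proj₁ (∈-range⁻ R 0 (card A) (∈.∈-lookup {xs = vs} i)))
      g : Fin (length vs) → Fin (card A)
      g i = Fin.fromℕ< (v< i)
      toℕ-g : ∀ i → toℕ (g i) ≡ List.lookup vs i
      toℕ-g i = Fin.toℕ-fromℕ< (v< i)
      g-inj : ∀ {i j} → g i ≡ g j → i ≡ j
      g-inj {i} {j} eq = lookup-injective (range-unique R 0 (card A)) i j
        (trans (sym (toℕ-g i)) (trans (cong toℕ eq) (toℕ-g j)))
      B = pullback A g g-inj
      g-onto : ∀ {a} → R (toℕ a) ≡ true → ∃[ i ] (g i ≡ a)
      g-onto {a} Ra = Any.index a∈ , Fin.toℕ-injective (trans (toℕ-g _) (sym (Any.lookup-index a∈)))
        where
        a∈ : toℕ a ∈ vs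
        a∈ = ∈-range⁺ R 0 (card A) z≤n (Fin.toℕ<n a) Ra
      selected≤N : ∀ E → length (select E R edgesOf) ℕ.≤ N E B
      selected≤N E = length≤N B E (toℕ ∘ g) (select-apart E R (Valid.apart edgesOf-valid)) λ X∈ →
        let e∈ , covered = ∈-select⁻ E R edgesOf X∈ in tuple-in-B covered (edgesOf-sound e∈)
        where
        tuple-in-B : ∀ {X} → covers R X ≡ true → ∃[ as ] (T (rel A E as) × X ≡ toℕs as) →
          ∃[ bs ] (T (rel B E bs) × X ≋ List.map (toℕ ∘ g) (toList bs))
        tuple-in-B covered (as , Eas , refl)
          with Vec-preimage g as (λ a∈ → g-onto (covers⁻ R covered (∈.∈-map⁺ toℕ a∈)))
        ... | bs , refl = bs , Eas , subst (toℕs (Vec.map g bs) ≋_)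
          (trans (cong (List.map toℕ) (Vec.toList-map g bs)) (sym (List.map-∘ (toList bs)))) ≋-refl

  module _ {n : ℕ} {es : List Edge} (valid : Valid n es) where

    Holds : ∀ E → Vec (Fin n) (arity L E) → Set
    Holds E as = VecUnique as × ∃[ X ] ((E , X) ∈ es × X ≋ toℕs as)

    Holds-↭ : ∀ E {as bs} → toList as ↭ toList bs → Holds E as → Holds E bs
    Holds-↭ E p (as! , X , e∈ , X≋) = toList-unique⁻ (unique-resp-↭ p (toList-unique⁺ as!))
      , X , e∈ , ≋-trans X≋ (map-≋ toℕ (↭⇒≋ p))

    T-does⁻ : ∀ {P : Set} → T (does (em {P})) → P
    T-does⁻ {P} t with em {P}
    ... | yes p = p

    T-does⁺ : ∀ {P : Set} → P → T (does (em {P}))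
    T-does⁺ {P} p with em {P}
    ... | yes _ = _
    ... | no ¬p = ¬p p

    realise : Structure L
    realise = record
      { card = n
      ; rel = λ E as → does (em {Holds E as})
      ; symmetric = λ E p → does-⇔ (mk⇔ (Holds-↭ E p) (Holds-↭ E (↭-sym p))) em em
      ; irreflexive = λ E t → proj₁ (T-does⁻ t) }

    -- Sparsity is applied to the image `R` of `B`: holding sets of `B` give different edges inside
    -- `R`, and `R` has at most `card B` elements.
    realise-hereditary : Sparse n es → Hereditary realise
    realise-hereditary sparse B f = begin
      total (λ E → N E B)                       ≤⟨ total-mono N≤selected ⟩
      total (λ E → length (select E R es))      ≈⟨ load≈total R es ⟨
      load R es                                 ≤⟨ sparse R ⟩
      size n R                                  ≤⟨ #1-mono image≤ ⟩
      card B #1                                 ∎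
      where
      h : Fin (card B) → ℕ
      h = toℕ ∘ to f
      R : Region
      R x = does (em {∃[ i ] (x ≡ h i)})
      image≤ : count R 0 n ℕ.≤ card B
      image≤ = subst₂ ℕ._≤_ (length-range R 0 n) (List.length-tabulate {n = card B} (λ i → i))
        (pigeonhole (λ x i → x ≡ h i)
          (AllPairs.map (λ x≢y i x≡ y≡ → x≢y (trans x≡ (sym y≡))) (range-unique R 0 n))
          λ x∈ → let i , x≡ = T-does⁻ (subst T (sym (proj₂ (∈-range⁻ R 0 n x∈))) _) in i , ∈.∈-allFin i , x≡)
      N≤selected : ∀ E → N E B ℕ.≤ length (select E R es)
      N≤selected E = N≤length B E h (λ eq → injective f (Fin.toℕ-injective eq)) λ as Eas →
        let _ , X , e∈ , X≋ = T-does⁻ (subst T (sym (rel-≡ f E as)) Eas)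
            X≋h = subst (X ≋_) (toℕs-map as) X≋
        in X , ∈-select⁺ E R es e∈ (covers⁺ R X λ x∈ → in-image as (proj₁ X≋h x∈)) , X≋h
        where
        toℕs-map : ∀ {r} (as : Vec (Fin (card B)) r) → toℕs (Vec.map (to f) as) ≡ List.map h (toList as)
        toℕs-map as = trans (cong (List.map toℕ) (Vec.toList-map (to f) as)) (sym (List.map-∘ (toList as)))
        in-image : ∀ {r} (as : Vec (Fin (card B)) r) {x} → x ∈ List.map h (toList as) → R x ≡ true
        in-image as x∈ with ∈.∈-map⁻ h x∈
        ... | i , _ , x≡ = dec-true em (i , x≡)

    load≼total-realise : load full es ≼ total (λ E → N E realise)
    load≼total-realise = begin
      load full es                               ≈⟨ load≈total full es ⟩
      total (λ E → length (select E full es))    ≤⟨ total-mono selected≤N ⟩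
      total (λ E → N E realise)                  ∎
      where
      tuple : ∀ {E X} → (E , X) ∈ es → ∃[ as ] (T (rel realise E as) × X ≋ toℕs as)
      tuple {E} {X} e∈ with All.lookup (Valid.wellFormed valid) e∈
      ... | X-length , X! , X< with fromℕs X X< X-length
      ...   | as , refl = as , T-does⁺ (toList-unique⁻ (Unique.map⁻ X!) , X , e∈ , ≋-refl) , ≋-refl
      selected≤N : ∀ E → length (select E full es) ℕ.≤ N E realise
      selected≤N E = length≤N realise E toℕ (select-apart E full (Valid.apart valid)) λ X∈ →
        tuple (proj₁ (∈-select⁻ E full es X∈))

  realise-↪ : ∀ (A : Structure L) {n es} (valid : Valid n es) → Extension (card A) (edgesOf A) n es → A ↪ realise valid
  realise-↪ A {n} {es} valid ext = record
    { to = λ i → Fin.inject≤ i X.n≤n′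
    ; injective = Fin.inject≤-injective X.n≤n′ X.n≤n′ _ _
    ; rel-≡ = λ E as → same E as (rel A E as) refl }
    where
    module X = Extension ext
    ι : Fin (card A) → Fin n
    ι i = Fin.inject≤ i X.n≤n′
    toℕs-ι : ∀ {r} (as : Vec (Fin (card A)) r) → toℕs (Vec.map ι as) ≡ toℕs as
    toℕs-ι []       = refl
    toℕs-ι (a ∷ as) = cong₂ _∷_ (Fin.toℕ-inject≤ a X.n≤n′) (toℕs-ι as)
    holds : ∀ E as → T (rel A E as) → Holds valid E (Vec.map ι as)
    holds E as Eas with edgesOf-complete A E as Eas
    ... | X , e∈ , X≋ =
      toList-unique⁻ (Unique.map⁻ (subst Unique (sym (toℕs-ι as))
        (Unique.map⁺ Fin.toℕ-injective (toList-unique⁺ (irreflexive A E Eas)))))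
      , X , X.keeps e∈ , subst (X ≋_) (sym (toℕs-ι as)) X≋
    reflects : ∀ E as → Holds valid E (Vec.map ι as) → T (rel A E as)
    reflects E as (as! , X , e∈ , X≋)
      with edgesOf-sound A (X.induced e∈ (All.anti-mono (proj₁ (subst (X ≋_) (toℕs-ι as) X≋)) (toℕs-< as)))
    -- The edge that was found may enumerate the set in another order; both enumerations are free of
    -- repetition, so they are permutations of each other and symmetry of `A` applies.
    ... | bs , Ebs , refl = subst T (symmetric A E (unique-≋⇒↭ (toList-unique⁺ (irreflexive A E Ebs))
        (Unique.map⁻ (subst Unique (Vec.toList-map ι as) (toList-unique⁺ as!)))
        (map-≋⁻ toℕ Fin.toℕ-injective (subst (toℕs bs ≋_) (toℕs-ι as) X≋)))) Ebs
    same : ∀ E as b → rel A E as ≡ b → rel (realise valid) E (Vec.map ι as) ≡ rel A E as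
    same E as true  eq = trans (dec-true em (holds E as (subst T (sym eq) _))) (sym eq)
    same E as false eq = trans (dec-false em λ h → subst T eq (reflects E as h)) (sym eq)

-- Integral coherence and the extension theorem over an ordered group

module Predimension (em : ExcludedMiddle 0ℓ) (G : OrderedAbelianGroup) (L : Language)
         (α : Symbol L → OrderedAbelianGroup.Carrier G) (P : Charging.Params em G L α) where
  open OrderedAbelianGroup G
  open OrderedAbelianGroupProperties G
  open Load G L α
  open Charging em G L α using (module Params; module Weights)
  open Params P
  open Weights P
  open Hypergraph em G L α 0≼α
  open Closing em G L α P
  open Translation em G L α 0≼α
  open ≼-Reasoning

  module _ (m : Symbol L → ℕ) (1≤m : ∀ E → 1 ℕ.≤ m E) where

    weight-replicate : ∀ k E → weight (List.replicate k E) ≈ k ⋆ α E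
    weight-replicate zero    E = ≈-refl
    weight-replicate (suc k) E = ⊕-congˡ (weight-replicate k E)

    -- The multiset with `m E` copies of each `E`; it is used with `ι` the identity, and a general
    -- `ι` lets the recursion pass to fewer symbols.
    bag : ∀ {k} → (Fin k → Symbol L) → List (Symbol L)
    bag {zero}  ι = []
    bag {suc k} ι = List.replicate (m (ι Fin.zero)) (ι Fin.zero) ++ bag (ι ∘ Fin.suc)

    weight-bag : ∀ {k} (ι : Fin k → Symbol L) → weight (bag ι) ≈ ∑ (λ i → m (ι i) ⋆ α (ι i))
    weight-bag {zero}  ι = ≈-refl
    weight-bag {suc k} ι = ≈-trans (weight-++ (List.replicate (m (ι Fin.zero)) (ι Fin.zero)) (bag (ι ∘ Fin.suc)))
      (⊕-cong (weight-replicate (m (ι Fin.zero)) (ι Fin.zero)) (weight-bag (ι ∘ Fin.suc)))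

    ∈-bag : ∀ {k} (ι : Fin k → Symbol L) i → ι i ∈ bag ι
    ∈-bag ι Fin.zero = ∈.∈-++⁺ˡ (∈-replicate (1≤m (ι Fin.zero)))
      where
      ∈-replicate : ∀ {k} {E : Symbol L} → 1 ℕ.≤ k → E ∈ List.replicate k E
      ∈-replicate (s≤s _) = here refl
    ∈-bag ι (Fin.suc i) = ∈.∈-++⁺ʳ (List.replicate (m (ι Fin.zero)) (ι Fin.zero)) (∈-bag (ι ∘ Fin.suc) i)

    copies : ∀ d Es → ∃[ Fs ] (weight Fs ≈ d ⋆ weight Es)
    copies zero    Es = [] , ≈-refl
    copies (suc d) Es with copies d Es
    ... | Fs , eq = Es ++ Fs , ≈-trans (weight-++ Es Fs) (⊕-congˡ eq)

    -- As `1 ≤ m E`, the bag contains `E`. Removing one copy of it from `suc d` bags leaves the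
    -- complement.
    complement-in-multiple : ∀ d E → ∃[ Es ] (α E ⊕ weight Es ≈ suc d ⋆ total m)
    complement-in-multiple d E with ∈.∈-∃++ (∈-bag (λ E → E) E) | copies d (bag (λ E → E))
    ... | us , vs , eq | Fs , eq′ = (us ++ vs) ++ Fs , (begin-equality
      α E ⊕ weight ((us ++ vs) ++ Fs)              ≈⟨ ⊕-congˡ (≈-trans (weight-++ (us ++ vs) Fs) (⊕-congʳ (weight-++ us vs))) ⟩
      α E ⊕ ((weight us ⊕ weight vs) ⊕ weight Fs)
        ≈⟨ solve 4 (λ a u v f → (a :+ ((u :+ v) :+ f)) ⊜ ((u :+ (a :+ v)) :+ f)) ≈-refl (α E) (weight us) (weight vs) (weight Fs) ⟩
      (weight us ⊕ (α E ⊕ weight vs)) ⊕ weight Fs  ≈⟨ ⊕-congʳ (weight-++ us (E ∷ vs)) ⟨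
      weight (us ++ E ∷ vs) ⊕ weight Fs            ≡⟨ cong (λ Es → weight Es ⊕ weight Fs) eq ⟨
      weight (bag (λ E → E)) ⊕ weight Fs           ≈⟨ ⊕-cong bag≈ (≈-trans eq′ (×-congʳ monoid d bag≈)) ⟩
      suc d ⋆ total m                              ∎)
      where
      bag≈ : weight (bag (λ E → E)) ≈ total m
      bag≈ = weight-bag (λ E → E)

    -- Excludes a zero or negative numerator of the rational number in the coherence hypothesis.
    multiple≰0 : Symbol L → ∀ d → ¬ (suc d ⋆ total m ≼ 0#)
    multiple≰0 E d le with complement-in-multiple d E
    ... | Es , eq = ε≰0 (begin
      ε                ≤⟨ ε≼α E ⟩
      α E              ≤⟨ x≼x⊕y (α E) (0≼weight Es) ⟩
      α E ⊕ weight Es  ≈⟨ eq ⟩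
      suc d ⋆ total m  ≤⟨ le ⟩
      0#               ∎)

    coherence : Symbol L → ∀ d u → suc d ⋆ total m ≈ u #1 → Coherence
    coherence E d u eq = record
      { unit = u ; 1≤unit = 1≤u u eq ; symbol = E
      ; complement = λ E → let Es , eq′ = complement-in-multiple d E in Es , ≈-trans eq′ eq }
      where
      1≤u : ∀ u → suc d ⋆ total m ≈ u #1 → 1 ℕ.≤ u
      1≤u zero    eq = contradiction (≼-reflexive eq) (multiple≰0 E d)
      1≤u (suc u) eq = s≤s z≤n

  -- On the reals the cardinality enters as the constant sequence `fromℕ n`, which equals the n-fold
  -- sum of 1 only up to `_≃_`; `dim` stands for it.
  module _ (coherence : Coherence) (dim : ℕ → Carrier) (dim≈#1 : ∀ n → dim n ≈ n #1) where

    predimension : Structure L → Carrier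
    predimension A = dim (card A) ⊕ ⊖ total (λ E → N E A)

    ≼#1⇒≼dim : ∀ n {x} → x ≼ n #1 → x ≼ dim n
    ≼#1⇒≼dim n x≼n = ≼-trans x≼n (≼-reflexive (≈-sym (dim≈#1 n)))

    extend : ∀ A → (∀ B → B ↪ A → 0# ≼ predimension B) →
      ∃[ D ] ((∀ B → B ↪ D → 0# ≼ predimension B) × (A ↪ D) × predimension D ≈ 0#)
    extend A nonneg = D
      , (λ B B↪D → x≼y⇒0≼y⊖x _ _ (≼#1⇒≼dim (card B) (D-hereditary B B↪D)))
      , realise-↪ A C.valid C.extension
      , x≼y≼x⇒y⊖x≈0 _ _ (≼#1⇒≼dim (card D) (D-hereditary D ↪-refl))
          (≼-trans (≼-reflexive (dim≈#1 (card D))) (≼-trans C.tight (load≼total-realise C.valid)))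
      where
      A-hereditary : Hereditary A
      A-hereditary B B↪A = ≼-trans (0≼y⊖x⇒x≼y _ _ (nonneg B B↪A)) (≼-reflexive (dim≈#1 (card B)))
      module C = Closure (closure coherence (edgesOf-valid A) (edgesOf-sparse A A-hereditary))
      D = realise C.valid
      D-hereditary = realise-hereditary C.valid C.sparse
      ↪-refl : D ↪ D
      ↪-refl = record { to = λ i → i ; injective = λ eq → eq ; rel-≡ = λ E as → cong (rel D E) (Vec.map-id as) }

-- Specialisation to real weights

module OverℝWithEM (em : ExcludedMiddle 0ℓ) (L : Language) (α : Weights L) where
  G : OrderedAbelianGroup
  G = ℝ-orderedAbelianGroup em

  lightest : Symbol L → ∃[ E ] (∀ E′ → α E ≤ α E′)
  lightest symbol = OrderedAbelianGroupProperties.argmin G symbol α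

  NullExtension : Structure L → Set
  NullExtension A = ∃[ D ] (InK α D × (A ↪ D) × δ α D ≃ 0ℝ)

  module _ (params : Charging.Params em G L α) (m : Symbol L → ℕ) (1≤m : ∀ E → 1 ℕ.≤ m E) (symbol : Symbol L) where
    module M = Predimension em G L α params

    S : ℝ
    S = sum (λ E → m E · α E)

    cleared : ∀ q → S ≃ fromℚ q → ℚ.↧ₙ q · S ≃ fromℚ (ℚ.↥ q ℚ./ 1)
    cleared q eq = Real.≃-trans (ℚ.↧ₙ q · S) (ℚ.↧ₙ q · fromℚ q) (fromℚ (ℚ.↥ q ℚ./ 1))
      (Real.·-cong (ℚ.↧ₙ q) S (fromℚ q) eq) (Real.↧·fromℚ q)

    coherence : ∀ q → S ≃ fromℚ q → Closing.Coherence em G L α params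
    -- The denominator `suc d` of q clears the fraction, so `suc d` bags have the integral weight
    -- `u`.
    coherence q@(ℚ.mkℚ (+ u) d _) eq = M.coherence m 1≤m symbol d u
      (Real.≃-trans (suc d · S) (fromℕ u) (u · 1ℝ) (cleared q eq) (Real.fromℕ≃·1 u))
    coherence q@(ℚ.mkℚ -[1+ u ] d _) eq = ⊥-elim (M.multiple≰0 m 1≤m symbol d
      (Real.≤-trans (suc d · S) (fromℚ (-[1+ u ] ℚ./ 1)) 0ℝ
        (Real.≃⇒≤ (suc d · S) (fromℚ (-[1+ u ] ℚ./ 1)) (cleared q eq))
        (Real.≤-ptw (fromℚ (-[1+ u ] ℚ./ 1)) 0ℝ λ _ → Real./1-mono { -[1+ u ]} {+ 0} ℤ.-≤+)))

    extendWith : ∀ q → S ≃ fromℚ q → ∀ A → InK α A → NullExtension A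
    extendWith q eq = M.extend (coherence q eq) fromℕ Real.fromℕ≃·1

  extendByLightest : ∀ E₀ K → ¬ (α E₀ ≤ 0ℝ) → (∀ E → α E₀ ≤ α E) → (∀ E → α E ≤ 1ℝ) → 1ℝ ≤ K · α E₀ →
    Coherent L α → ∀ A → InK α A → NullExtension A
  extendByLightest E₀ K α≰0 α₀≤α α≤1 1≤Kα (m , 1≤m , q , sum≃q) = extendWith
    (record { ε = α E₀ ; ε≰0 = α≰0 ; ε≼α = α₀≤α ; α≼1 = α≤1 ; K = K ; 1≼Kε = 1≤Kα }) m 1≤m E₀ q sum≃q

  nullExtension : InUnitInterval L α → ∃[ E₀ ] (∀ E → α E₀ ≤ α E) → (∀ E → ∃[ k ] (1ℝ ≤ k · α E)) →
    Coherent L α → ∀ A → InK α A → NullExtension A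
  nullExtension α∈[0,1] (E₀ , α₀≤α) archimedean = extendByLightest E₀ (proj₁ (archimedean E₀))
    (Real.<⇒≰ 0ℝ (α E₀) (proj₁ (α∈[0,1] E₀))) α₀≤α (λ E → proj₂ (α∈[0,1] E)) (proj₂ (archimedean E₀))

  -- In a language without symbols `AllBinaryOfWeightOne` would hold vacuously.
  symbol : ¬ AllBinaryOfWeightOne L α → Symbol L
  symbol ¬binary with em {Symbol L}
  ... | yes E = E
  ... | no ∄E = ⊥-elim (¬binary λ E → ⊥-elim (∄E E))

  weights-archimedean : InUnitInterval L α → ∀ E → ∃[ k ] (1ℝ ≤ k · α E)
  weights-archimedean α∈[0,1] E = Real.archimedean (α E) (proj₁ (α∈[0,1] E))

theorem3p39 : ExcludedMiddle 0ℓ →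
    (L : Language) (α : Weights L) →
    InUnitInterval L α →
    ¬ AllBinaryOfWeightOne L α →
    Coherent L α →
    (A : Structure L) → InK α A → 0ℝ < δ α A →
    ∃[ D ] (InK α D × (A ↪ D) × δ α D ≃ 0ℝ)
theorem3p39 em L α α∈[0,1] ¬binary coherent A A∈K _ =
  nullExtension α∈[0,1] (lightest (symbol ¬binary)) (weights-archimedean α∈[0,1]) coherent A A∈K
  where open OverℝWithEM em L α
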